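{- The change of basis $\frac{x}{(1-x)^{k+1}}\mapsto x(1-x)^{k-1}$ ($k\ge 1$), extended linearly, is an operadic isomorphism of algebras over the operad $\mathcal{FP}$ of finite posets from the algebra of weak order series $\{\mathfrak{Z}^+(P)\}$ to the algebra of weak surjective order series $\{\mathfrak{Z}^{s}(P)\}$, where $P$ ranges over finite posets.
   Context: Posets are finite and nonempty. For a poset $P$ on points $x_1,\dots,x_k$ and posets $Q_1,\dots,Q_k$, the lexicographic sum $\widetilde{P}(Q_1,\dots,Q_k)$ is the poset on $\bigsqcup_i Q_i$ with $a\le b$ iff either $a,b\in Q_i$ for some $i$ and $a\le_{Q_i}b$, or $a\in Q_i$, $b\in Q_j$ with $x_i<_P x_j$. The operad $\mathcal{FP}$ has as $k$-ary operations the posets with $k$ points, with lexicographic sum as operadic composition. $\Omega^\circ(P,n)$ is the number of strict order-preserving maps $P\to\langle n\rangle=\{1<\cdots<n\}$, and the integers $d_{P,i}$ are defined by $\Omega^\circ(P,x)=\sum_{i=1}^{|P|}d_{P,i}\binom{x}{i}$. Define $$\mathfrak{Z}^+(P)=\sum_{n\ge 1}\Omega(P,n)x^n=\sum_{i=1}^{|P|}(-1)^{|P|-i}d_{P,i}\frac{x}{(1-x)^{i+1}},\qquad \mathfrak{Z}^{s}(P)=\sum_{i=1}^{|P|}(-1)^{|P|-i}d_{P,i}\,x(1-x)^{i-1},$$ where $\Omega(P,n)$ is the number of weakly order-preserving maps $P\to\langle n\rangle$. Elements of both algebras are series together with the poset that produced them, and the action of $\mathcal{FP}$ is $$\widetilde{P}(\mathfrak{Z}^{\bullet}(P_1),\dots,\mathfrak{Z}^{\bullet}(P_k))=\mathfrak{Z}^{\bullet}(\widetilde{P}(P_1,\dots,P_k)),\qquad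 k=|P|,\ \bullet\in\{+,s\}.$$ An operadic isomorphism is a bijection commuting with all these actions. -}

module Defs where

open import Data.Bool.Base using (Bool; true; false; if_then_else_)
open import Data.Empty using (⊥-elim)
open import Data.Fin.Base as Fin using (Fin; zero; suc; toℕ; finToFun; funToFin)
import Data.Fin.Properties as Fin
open import Data.Fin.Permutation using (↔⇒≡)
open import Data.Integer.Base as ℤ using (ℤ; +_; 0ℤ; 1ℤ; -1ℤ)
import Data.Integer.Properties as ℤ
open import Data.Integer.Tactic.RingSolver using (solve-∀)
open import Data.Nat.Base as ℕ using (ℕ; zero; suc; NonZero)
import Data.Nat.Properties as ℕ
open import Data.Nat.Combinatorics using (_C_; nCk+nC[k+1]≡[n+1]C[k+1])
open import Data.Product.Base using (Σ; Σ-syntax; _×_; _,_; proj₁; proj₂; swap)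
open import Data.Sum.Base using (inj₁; inj₂)
open import Data.Vec.Base using (Vec; []; _∷_; lookup; map; replicate; tabulate)
open import Data.Vec.Properties using (lookup-map; lookup∘tabulate)
open import Function.Base using (_∘_; id)
open import Function.Bundles using (_↔_; Inverse; mk↔ₛ′; _⇔_; Equivalence; mk⇔)
open import Function.Construct.Composition using (_↔-∘_)
open import Function.Construct.Identity using (↔-id)
open import Function.Construct.Symmetry using (↔-sym)
open import Function.Structures using (IsBijection)
open import Level using (0ℓ) renaming (suc to lsuc)
open import Relation.Binary.Bundles using (Setoid)
open import Relation.Binary.Core using (Rel)
open import Relation.Binary.Definitions using (Decidable)
open import Relation.Binary.PropositionalEquality
  using (_≡_; refl; sym; trans; cong; cong₂; _≗_; isEquivalence; module ≡-Reasoning)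
open import Relation.Binary.Structures using (IsDecPartialOrder)
open import Relation.Nullary.Decidable using (Dec; yes; no; does; does-⇔; _→-dec_; map′)
import Relation.Binary.Construct.NonStrictToStrict as ToStrict

open import Algebra.Properties.Semiring.Sum ℕ.+-*-semiring
  using () renaming (sum to sumℕ; sum-cong-≗ to sumℕ-cong; sum-permute to sumℕ-permute)
open import Algebra.Properties.Semiring.Sum ℤ.+-*-semiring
  using (sum; sum-syntax; sum-cong-≗; ∑-comm; ∑-distrib-+; sum-replicate-zero)

record FP (k : ℕ) : Set₁ where
  infix 4 _≤_ _<_
  field
    nonEmpty          : NonZero k
    _≤_               : Rel (Fin k) 0ℓ
    isDecPartialOrder : IsDecPartialOrder _≡_ _≤_

  open IsDecPartialOrder isDecPartialOrder public
    using (_≤?_; antisym) renaming (reflexive to ≤-reflexive; refl to ≤-refl; trans to ≤-trans)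

  _<_ : Rel (Fin k) 0ℓ
  _<_ = ToStrict._<_ _≡_ _≤_

  _<?_ : Decidable _<_
  _<?_ = ToStrict.<-decidable _≡_ _≤_ Fin._≟_ _≤?_

record _≅_ {m n : ℕ} (P : FP m) (Q : FP n) : Set where
  private
    module P = FP P
    module Q = FP Q
  field
    points : Fin m ↔ Fin n
  open Inverse points public using (to; from; strictlyInverseˡ; strictlyInverseʳ)
  field
    mono   : ∀ {x y} → x P.≤ y → to x Q.≤ to y
    cancel : ∀ {x y} → to x Q.≤ to y → x P.≤ y

≅-refl : ∀ {m} {P : FP m} → P ≅ P
≅-refl {m} = record { points = ↔-id (Fin m) ; mono = id ; cancel = id }

≅-sym : ∀ {m n} {P : FP m} {Q : FP n} → P ≅ Q → Q ≅ P
≅-sym {P = P} {Q} e = record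
  { points = ↔-sym points
  ; mono   = λ {x} {y} x≤y → cancel (subst₂′ (sym (strictlyInverseˡ x)) (sym (strictlyInverseˡ y)) x≤y)
  ; cancel = λ {x} {y} p → subst₂′ (strictlyInverseˡ x) (strictlyInverseˡ y) (mono p)
  }
  where
  open _≅_ e
  subst₂′ : ∀ {a b c d} → a ≡ b → c ≡ d → FP._≤_ Q a c → FP._≤_ Q b d
  subst₂′ refl refl p = p

≅-trans : ∀ {l m n} {P : FP l} {Q : FP m} {R : FP n} → P ≅ Q → Q ≅ R → P ≅ R
≅-trans e f = record
  { points = _≅_.points f ↔-∘ _≅_.points e
  ; mono   = _≅_.mono f ∘ _≅_.mono e
  ; cancel = _≅_.cancel e ∘ _≅_.cancel f
  }

-- Lists the disjoint union block by block.
split : ∀ {k} (n : Fin k → ℕ) → Fin (sumℕ n) → Σ (Fin k) (Fin ∘ n)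
split {suc k} n x with Fin.splitAt (n zero) x
... | inj₁ a = zero , a
... | inj₂ y = let (i , a) = split (n ∘ suc) y in suc i , a

unsplit : ∀ {k} (n : Fin k → ℕ) → Σ (Fin k) (Fin ∘ n) → Fin (sumℕ n)
unsplit {suc k} n (zero  , a) = a Fin.↑ˡ sumℕ (n ∘ suc)
unsplit {suc k} n (suc i , a) = n zero Fin.↑ʳ unsplit (n ∘ suc) (i , a)

split-unsplit : ∀ {k} (n : Fin k → ℕ) → split n ∘ unsplit n ≗ id
split-unsplit {suc k} n (zero  , a)
  rewrite Fin.splitAt-↑ˡ (n zero) a (sumℕ (n ∘ suc)) = refl
split-unsplit {suc k} n (suc i , a)
  rewrite Fin.splitAt-↑ʳ (n zero) (sumℕ (n ∘ suc)) (unsplit (n ∘ suc) (i , a))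
        | split-unsplit (n ∘ suc) (i , a) = refl

unsplit-split : ∀ {k} (n : Fin k → ℕ) → unsplit n ∘ split n ≗ id
unsplit-split {suc k} n x
  with Fin.splitAt (n zero) x | Fin.join-splitAt (n zero) (sumℕ (n ∘ suc)) x
... | inj₁ a | eq = eq
... | inj₂ y | eq = trans (cong (n zero Fin.↑ʳ_) (unsplit-split (n ∘ suc) y)) eq

split↔ : ∀ {k} (n : Fin k → ℕ) → Fin (sumℕ n) ↔ Σ (Fin k) (Fin ∘ n)
split↔ n = mk↔ₛ′ (split n) (unsplit n) (split-unsplit n) (unsplit-split n)

data Lex {k} (P : FP k) {n : Fin k → ℕ} (Q : ∀ i → FP (n i)) : Rel (Σ (Fin k) (Fin ∘ n)) 0ℓ where
  within : ∀ {i a b} → FP._≤_ (Q i) a b → Lex P Q (i , a) (i , b)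
  across : ∀ {i j a b} → FP._<_ P i j → Lex P Q (i , a) (j , b)

Lex-refl : ∀ {k} (P : FP k) {n : Fin k → ℕ} (Q : ∀ i → FP (n i)) → ∀ {u v} → u ≡ v → Lex P Q u v
Lex-refl P Q {i , a} refl = within (FP.≤-refl (Q i))

Lex-trans : ∀ {k} (P : FP k) {n : Fin k → ℕ} (Q : ∀ i → FP (n i)) →
            ∀ {u v w} → Lex P Q u v → Lex P Q v w → Lex P Q u w
Lex-trans P Q (within p) (within {i} q) = within (FP.≤-trans (Q i) p q)
Lex-trans P Q (within _) (across q) = across q
Lex-trans P Q (across p) (within _) = across p
Lex-trans P Q (across (p , i≢j)) (across (q , _)) =
  across (FP.≤-trans P p q , λ { refl → i≢j (FP.antisym P p q) })

Lex-antisym : ∀ {k} (P : FP k) {n : Fin k → ℕ} (Q : ∀ i → FP (n i)) →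
              ∀ {u v} → Lex P Q u v → Lex P Q v u → u ≡ v
Lex-antisym P Q (within {i} p) (within q) = cong (i ,_) (FP.antisym (Q i) p q)
Lex-antisym P Q (within _) (across (_ , i≢i)) = ⊥-elim (i≢i refl)
Lex-antisym P Q (across (_ , i≢i)) (within _) = ⊥-elim (i≢i refl)
Lex-antisym P Q (across (p , i≢j)) (across (q , _)) = ⊥-elim (i≢j (FP.antisym P p q))

Lex-dec : ∀ {k} (P : FP k) {n : Fin k → ℕ} (Q : ∀ i → FP (n i)) → Decidable (Lex P Q)
Lex-dec P Q (i , a) (j , b) with i Fin.≟ j
... | yes refl = map′ within (λ { (within p) → p ; (across (_ , i≢i)) → ⊥-elim (i≢i refl) })
                      (FP._≤?_ (Q i) a b)
... | no i≢j   = map′ across (λ { (within _) → ⊥-elim (i≢j refl) ; (across p) → p })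
                      (FP._<?_ P i j)

sumℕ-nonZero : ∀ {k} (n : Fin k → ℕ) → NonZero k → (∀ i → NonZero (n i)) → NonZero (sumℕ n)
sumℕ-nonZero {suc k} n _ nz with n zero | nz zero
... | suc _ | _ = _

lexSum : ∀ {k} (P : FP k) {n : Fin k → ℕ} (Q : ∀ i → FP (n i)) → FP (sumℕ n)
lexSum P {n} Q = record
  { nonEmpty          = sumℕ-nonZero n (FP.nonEmpty P) (FP.nonEmpty ∘ Q)
  ; _≤_               = λ x y → Lex P Q (split n x) (split n y)
  ; isDecPartialOrder = record
    { isPartialOrder = record
      { isPreorder = record
        { isEquivalence = isEquivalence
        ; reflexive     = Lex-refl P Q ∘ cong (split n)
        ; trans         = Lex-trans P Q
        }
      ; antisym = λ {x} {y} p q → trans (sym (unsplit-split n x))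
          (trans (cong (unsplit n) (Lex-antisym P Q p q)) (unsplit-split n y))
      }
    ; _≟_  = Fin._≟_
    ; _≤?_ = λ x y → Lex-dec P Q (split n x) (split n y)
    }
  }

lexSum-cong : ∀ {k} (P : FP k) {m n : Fin k → ℕ} {Q : ∀ i → FP (m i)} {R : ∀ i → FP (n i)} →
              (∀ i → Q i ≅ R i) → lexSum P Q ≅ lexSum P R
lexSum-cong P {m} {n} {Q} {R} e = record
  { points = ↔-sym (split↔ n) ↔-∘ (Σ↔ ↔-∘ split↔ m)
  ; mono   = λ {x} {y} p → subst₂′ (sym (split-unsplit n (f (split m x)))) (sym (split-unsplit n (f (split m y)))) (f-mono p)
  ; cancel = λ {x} {y} p → f-cancel (split m x) (split m y) (subst₂′ (split-unsplit n (f (split m x))) (split-unsplit n (f (split m y))) p)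
  }
  where
  open _≅_
  subst₂′ : ∀ {a b c d} → a ≡ b → c ≡ d → Lex P R a c → Lex P R b d
  subst₂′ refl refl p = p
  f : Σ (Fin _) (Fin ∘ m) → Σ (Fin _) (Fin ∘ n)
  f (i , a) = i , to (e i) a
  g : Σ (Fin _) (Fin ∘ n) → Σ (Fin _) (Fin ∘ m)
  g (i , a) = i , from (e i) a
  Σ↔ : Σ (Fin _) (Fin ∘ m) ↔ Σ (Fin _) (Fin ∘ n)
  Σ↔ = mk↔ₛ′ f g (λ (i , a) → cong (i ,_) (strictlyInverseˡ (e i) a))
                 (λ (i , a) → cong (i ,_) (strictlyInverseʳ (e i) a))
  f-mono : ∀ {u v} → Lex P Q u v → Lex P R (f u) (f v)
  f-mono (within {i} p) = within (mono (e i) p)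
  f-mono (across p)     = across p
  f-cancel : ∀ u v → Lex P R (f u) (f v) → Lex P Q u v
  f-cancel (i , a) (.i , b) (within p) = within (cancel (e i) p)
  f-cancel (i , a) (j , b) (across p) = across p

-- The number of maps Fin m → Fin n with property A, the maps being coded by
-- the numbers below n ^ m.
count : ∀ {m n} {A : (Fin m → Fin n) → Set} → (∀ f → Dec (A f)) → ℕ
count {m} {n} A? = sumℕ {n ℕ.^ m} λ c → if does (A? (finToFun c)) then 1 else 0

Weak : ∀ {k} (P : FP k) {n} → (Fin k → Fin n) → Set
Weak P f = ∀ x y → x ≤ y → f x Fin.≤ f y
  where open FP P

Strict : ∀ {k} (P : FP k) {n} → (Fin k → Fin n) → Set
Strict P f = ∀ x y → x < y → f x Fin.< f y
  where open FP P

weak? : ∀ {k} (P : FP k) {n} (f : Fin k → Fin n) → Dec (Weak P f)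
weak? P f = Fin.all? λ x → Fin.all? λ y → (x ≤? y) →-dec (f x Fin.≤? f y)
  where open FP P

strict? : ∀ {k} (P : FP k) {n} (f : Fin k → Fin n) → Dec (Strict P f)
strict? P f = Fin.all? λ x → Fin.all? λ y → (x <? y) →-dec (f x Fin.<? f y)
  where open FP P

Ω : ∀ {k} → FP k → ℕ → ℕ
Ω P n = count (weak? P {n})

Ω° : ∀ {k} → FP k → ℕ → ℕ
Ω° P n = count (strict? P {n})

-- Δ i is the i-fold forward difference.
Δ : ℕ → (ℕ → ℤ) → ℕ → ℤ
Δ zero    F n = F n
Δ (suc i) F n = Δ i (λ m → F (suc m) ℤ.- F m) n

-- Newton's forward difference formula solves Ω°(P,x) = Σ d i * (x C i) for the
-- coefficients; see d-expansion.
d : ∀ {k} → FP k → ℕ → ℤ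
d P i = Δ i (λ n → + Ω° P n) 0

-- Ω° P is a polynomial function of degree at most k.  Sorting the maps into
-- ⟨ n + 1 ⟩ by their fibre over the least element expresses each difference
-- Ω°(n + 1) - Ω°(n) through maps from proper subsets of the points.
module Degree where

  ∇ : (ℕ → ℤ) → ℕ → ℤ
  ∇ F n = F (suc n) ℤ.- F n

  Δ-cong : ∀ i {F G} → F ≗ G → Δ i F ≗ Δ i G
  Δ-cong zero    e n = e n
  Δ-cong (suc i) e n = Δ-cong i (λ m → cong₂ ℤ._-_ (e (suc m)) (e m)) n

  Δ-zero : ∀ i n → Δ i (λ _ → 0ℤ) n ≡ 0ℤ
  Δ-zero zero    n = refl
  Δ-zero (suc i) n = Δ-zero i n

  Δ-+ : ∀ i F G n → Δ i (λ m → F m ℤ.+ G m) n ≡ Δ i F n ℤ.+ Δ i G n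
  Δ-+ zero    F G n = refl
  Δ-+ (suc i) F G n = trans
    (Δ-cong i (λ m → lemma (F (suc m)) (G (suc m)) (F m) (G m)) n)
    (Δ-+ i (∇ F) (∇ G) n)
    where
    lemma : ∀ a b c e → (a ℤ.+ b) ℤ.- (c ℤ.+ e) ≡ (a ℤ.- c) ℤ.+ (b ℤ.- e)
    lemma = solve-∀

  -- Vanishing of an iterated difference: F is a polynomial of degree less than i.
  Deg< : ℕ → (ℕ → ℤ) → Set
  Deg< i F = ∀ n → Δ i F n ≡ 0ℤ

  Deg<-+ : ∀ {i F G} → Deg< i F → Deg< i G → Deg< i (λ n → F n ℤ.+ G n)
  Deg<-+ {i} {F} {G} p q n = trans (Δ-+ i F G n) (cong₂ ℤ._+_ (p n) (q n))

  Deg<-zero : ∀ i → Deg< i (λ _ → 0ℤ)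
  Deg<-zero = Δ-zero

  Deg<-resp : ∀ i {F G} → F ≗ G → Deg< i G → Deg< i F
  Deg<-resp i e p n = trans (Δ-cong i e n) (p n)

  Deg<-mono : ∀ {i j F} → i ℕ.≤ j → Deg< i F → Deg< j F
  Deg<-mono {j = j} ℕ.z≤n p = Deg<-resp j p (Deg<-zero j)
  Deg<-mono (ℕ.s≤s i≤j)     p = Deg<-mono i≤j p

  newton : ∀ m F → Deg< m F → ∀ n → F n ≡ ∑[ i < m ] (Δ (toℕ i) F 0 ℤ.* + (n C toℕ i))
  newton zero    F p n = p n
  newton (suc m) F p zero = sym (begin
    F 0 ℤ.* 1ℤ ℤ.+ ∑[ i < m ] (Δ (suc (toℕ i)) F 0 ℤ.* 0ℤ)
      ≡⟨ cong₂ ℤ._+_ (ℤ.*-identityʳ (F 0)) (sum-cong-≗ {m} λ i → ℤ.*-zeroʳ (Δ (suc (toℕ i)) F 0)) ⟩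
    F 0 ℤ.+ ∑[ i < m ] 0ℤ
      ≡⟨ cong (λ s → F 0 ℤ.+ s) (sum-replicate-zero m) ⟩
    F 0 ℤ.+ 0ℤ
      ≡⟨ ℤ.+-identityʳ (F 0) ⟩
    F 0 ∎)
    where open ≡-Reasoning
  newton (suc m) F p (suc n) = begin
    F (suc n)
      ≡⟨ split-∇ (F (suc n)) (F n) ⟩
    F n ℤ.+ ∇ F n
      ≡⟨ cong₂ ℤ._+_ (newton (suc m) F p n) (newton m (∇ F) p n) ⟩
    (F 0 ℤ.* 1ℤ ℤ.+ ∑[ i < m ] (c i ℤ.* + (n C suc (toℕ i)))) ℤ.+ ∑[ i < m ] (c i ℤ.* + (n C toℕ i))
      ≡⟨ ℤ.+-assoc (F 0 ℤ.* 1ℤ) (∑[ i < m ] (c i ℤ.* + (n C suc (toℕ i)))) _ ⟩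
    F 0 ℤ.* 1ℤ ℤ.+ (∑[ i < m ] (c i ℤ.* + (n C suc (toℕ i))) ℤ.+ ∑[ i < m ] (c i ℤ.* + (n C toℕ i)))
      ≡⟨ cong (λ s → F 0 ℤ.* 1ℤ ℤ.+ s) (sym (∑-distrib-+ {m} (λ i → c i ℤ.* + (n C suc (toℕ i))) _)) ⟩
    F 0 ℤ.* 1ℤ ℤ.+ ∑[ i < m ] (c i ℤ.* + (n C suc (toℕ i)) ℤ.+ c i ℤ.* + (n C toℕ i))
      ≡⟨ cong (λ s → F 0 ℤ.* 1ℤ ℤ.+ s) (sum-cong-≗ {m} pascal) ⟩
    F 0 ℤ.* 1ℤ ℤ.+ ∑[ i < m ] (c i ℤ.* + (suc n C suc (toℕ i))) ∎
    where
    open ≡-Reasoning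
    c : Fin m → ℤ
    c i = Δ (suc (toℕ i)) F 0
    split-∇ : ∀ a b → a ≡ b ℤ.+ (a ℤ.- b)
    split-∇ = solve-∀
    pascal : ∀ i → c i ℤ.* + (n C suc (toℕ i)) ℤ.+ c i ℤ.* + (n C toℕ i) ≡ c i ℤ.* + (suc n C suc (toℕ i))
    pascal i = trans (sym (ℤ.*-distribˡ-+ (c i) _ _)) (cong (λ t → c i ℤ.* + t)
      (trans (ℕ.+-comm (n C suc (toℕ i)) _) (nCk+nC[k+1]≡[n+1]C[k+1] n (toℕ i))))

  -- The sum of w over all vectors with entries below n.
  S : ∀ m → ℕ → (Vec ℕ m → ℤ) → ℤ
  S zero    n w = w []
  S (suc m) n w = ∑[ a < n ] S m n (λ v → w (toℕ a ∷ v))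

  S-cong : ∀ m n {w w′} → w ≗ w′ → S m n w ≡ S m n w′
  S-cong zero    n e = e []
  S-cong (suc m) n e = sum-cong-≗ {n} λ a → S-cong m n (λ v → e (toℕ a ∷ v))

  -- A mask marks with false the entries equal to 0.
  size : ∀ {m} → Vec Bool m → ℕ
  size []           = 0
  size (false ∷ μ) = size μ
  size (true  ∷ μ) = suc (size μ)

  glue : ∀ {m} (μ : Vec Bool m) → Vec ℕ (size μ) → Vec ℕ m
  glue []          []       = []
  glue (false ∷ μ) u        = 0 ∷ glue μ u
  glue (true  ∷ μ) (a ∷ u) = suc a ∷ glue μ u

  ΣMask : ∀ m → (Vec Bool m → ℤ) → ℤ
  ΣMask zero    h = h []
  ΣMask (suc m) h = ΣMask m (h ∘ (false ∷_)) ℤ.+ ΣMask m (h ∘ (true ∷_))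

  ΣProper : ∀ m → (Vec Bool m → ℤ) → ℤ
  ΣProper zero    h = 0ℤ
  ΣProper (suc m) h = ΣMask m (h ∘ (false ∷_)) ℤ.+ ΣProper m (h ∘ (true ∷_))

  full : ∀ m → Vec Bool m
  full m = replicate m true

  ΣMask-full : ∀ m h → ΣMask m h ≡ ΣProper m h ℤ.+ h (full m)
  ΣMask-full zero    h = sym (ℤ.+-identityˡ (h []))
  ΣMask-full (suc m) h = trans
    (cong (λ s → ΣMask m (h ∘ (false ∷_)) ℤ.+ s) (ΣMask-full m (h ∘ (true ∷_))))
    (sym (ℤ.+-assoc (ΣMask m (h ∘ (false ∷_))) _ _))

  ΣMask-∑ : ∀ m n (h : Fin n → Vec Bool m → ℤ) →
            ∑[ a < n ] ΣMask m (h a) ≡ ΣMask m (λ μ → ∑[ a < n ] h a μ)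
  ΣMask-∑ zero    n h = refl
  ΣMask-∑ (suc m) n h = trans (∑-distrib-+ {n} (λ a → ΣMask m (h a ∘ (false ∷_))) _)
    (cong₂ ℤ._+_ (ΣMask-∑ m n (λ a → h a ∘ (false ∷_))) (ΣMask-∑ m n (λ a → h a ∘ (true ∷_))))

  S-suc : ∀ m n w → S m (suc n) w ≡ ΣMask m (λ μ → S (size μ) n (w ∘ glue μ))
  S-suc zero    n w = refl
  S-suc (suc m) n w = cong₂ ℤ._+_ (S-suc m n (w ∘ (0 ∷_))) (trans
    (sum-cong-≗ {n} λ a → S-suc m n (w ∘ (suc (toℕ a) ∷_)))
    (ΣMask-∑ m n (λ a μ → S (size μ) n (w ∘ (suc (toℕ a) ∷_) ∘ glue μ))))

  S-full : ∀ m n w → S (size (full m)) n (w ∘ glue (full m)) ≡ S m n (w ∘ map suc)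
  S-full zero    n w = refl
  S-full (suc m) n w = sum-cong-≗ {n} λ a → S-full m n (w ∘ (suc (toℕ a) ∷_))

  Invariant : ∀ {m} → (Vec ℕ m → ℤ) → Set
  Invariant w = ∀ φ → (∀ i j → (i ℕ.< j) ⇔ (φ i ℕ.< φ j)) → ∀ v → w (map φ v) ≡ w v

  lift : (ℕ → ℕ) → ℕ → ℕ
  lift φ zero    = zero
  lift φ (suc i) = suc (φ i)

  lift-< : ∀ φ → (∀ i j → (i ℕ.< j) ⇔ (φ i ℕ.< φ j)) → ∀ i j → (i ℕ.< j) ⇔ (lift φ i ℕ.< lift φ j)
  lift-< φ p zero    zero    = mk⇔ id id
  lift-< φ p zero    (suc j) = mk⇔ (λ _ → ℕ.z<s) (λ _ → ℕ.z<s)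
  lift-< φ p (suc i) zero    = mk⇔ (λ ()) (λ ())
  lift-< φ p (suc i) (suc j) =
    mk⇔ (ℕ.s<s ∘ Equivalence.to (p i j) ∘ ℕ.s<s⁻¹) (ℕ.s<s ∘ Equivalence.from (p i j) ∘ ℕ.s<s⁻¹)

  map-glue : ∀ {m} φ (μ : Vec Bool m) u → glue μ (map φ u) ≡ map (lift φ) (glue μ u)
  map-glue φ []          []      = refl
  map-glue φ (false ∷ μ) u       = cong (0 ∷_) (map-glue φ μ u)
  map-glue φ (true  ∷ μ) (a ∷ u) = cong (suc (φ a) ∷_) (map-glue φ μ u)

  glue-invariant : ∀ {m} (μ : Vec Bool m) {w} → Invariant w → Invariant (w ∘ glue μ)
  glue-invariant μ {w} inv φ p u =
    trans (cong w (map-glue φ μ u)) (inv (lift φ) (lift-< φ p) (glue μ u))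

  size≤ : ∀ {m} (μ : Vec Bool m) → size μ ℕ.≤ m
  size≤ []          = ℕ.z≤n
  size≤ (false ∷ μ) = ℕ.m≤n⇒m≤1+n (size≤ μ)
  size≤ (true  ∷ μ) = ℕ.s≤s (size≤ μ)

  Deg<-ΣMask : ∀ m i (h : ℕ → Vec Bool m → ℤ) → (∀ μ → Deg< i (λ n → h n μ)) →
               Deg< i (λ n → ΣMask m (h n))
  Deg<-ΣMask zero    i h p = p []
  Deg<-ΣMask (suc m) i h p = Deg<-+ {i}
    (Deg<-ΣMask m i (λ n → h n ∘ (false ∷_)) (p ∘ (false ∷_)))
    (Deg<-ΣMask m i (λ n → h n ∘ (true ∷_)) (p ∘ (true ∷_)))

  Deg<-ΣProper : ∀ m i (h : ℕ → Vec Bool m → ℤ) → (∀ μ → size μ ℕ.< m → Deg< i (λ n → h n μ)) →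
                 Deg< i (λ n → ΣProper m (h n))
  Deg<-ΣProper zero    i h p = Deg<-zero i
  Deg<-ΣProper (suc m) i h p = Deg<-+ {i}
    (Deg<-ΣMask m i (λ n → h n ∘ (false ∷_)) (λ μ → p (false ∷ μ) (ℕ.s≤s (size≤ μ))))
    (Deg<-ΣProper m i (λ n → h n ∘ (true ∷_)) (λ μ q → p (true ∷ μ) (ℕ.s<s q)))

  ∇-S : ∀ m w → Invariant w →
        ∀ n → ∇ (λ l → S m l w) n ≡ ΣProper m (λ μ → S (size μ) n (w ∘ glue μ))
  ∇-S m w inv n = begin
    S m (suc n) w ℤ.- S m n w
      ≡⟨ cong (ℤ._- S m n w) (trans (S-suc m n w) (ΣMask-full m h)) ⟩
    (ΣProper m h ℤ.+ h (full m)) ℤ.- S m n w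
      ≡⟨ cong (λ s → (ΣProper m h ℤ.+ s) ℤ.- S m n w) (trans (S-full m n w) (S-cong m n (inv suc (λ _ _ → mk⇔ ℕ.s<s ℕ.s<s⁻¹)))) ⟩
    (ΣProper m h ℤ.+ S m n w) ℤ.- S m n w
      ≡⟨ cancel (ΣProper m h) (S m n w) ⟩
    ΣProper m h ∎
    where
    open ≡-Reasoning
    h : Vec Bool m → ℤ
    h μ = S (size μ) n (w ∘ glue μ)
    cancel : ∀ a b → (a ℤ.+ b) ℤ.- b ≡ a
    cancel = solve-∀

  S-Deg< : ∀ N m w → m ℕ.< N → Invariant w → Deg< N (λ n → S m n w)
  S-Deg< (suc N) m w m<N inv =
    Deg<-resp N (∇-S m w inv)
      (Deg<-ΣProper m N (λ n μ → S (size μ) n (w ∘ glue μ)) λ μ q →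
        S-Deg< N (size μ) (w ∘ glue μ) (ℕ.<-≤-trans q (ℕ.s≤s⁻¹ m<N)) (glue-invariant μ inv))

  +-sum : ∀ {n} (t : Fin n → ℕ) → + sumℕ t ≡ sum (+_ ∘ t)
  +-sum {zero}  t = refl
  +-sum {suc n} t = cong (λ s → + t zero ℤ.+ s) (+-sum (t ∘ suc))

  sum-+ : ∀ m {n} (t : Fin (m ℕ.+ n) → ℤ) →
          sum t ≡ ∑[ i < m ] t (i Fin.↑ˡ n) ℤ.+ ∑[ j < n ] t (m Fin.↑ʳ j)
  sum-+ zero    t = sym (ℤ.+-identityˡ _)
  sum-+ (suc m) t = trans (cong (λ s → t zero ℤ.+ s) (sum-+ m (t ∘ suc))) (sym (ℤ.+-assoc (t zero) _ _))

  sum-* : ∀ m {n} (t : Fin (m ℕ.* n) → ℤ) → sum t ≡ ∑[ i < m ] ∑[ j < n ] t (Fin.combine i j)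
  sum-* zero        t = refl
  sum-* (suc m) {n} t = trans (sum-+ n t) (cong (λ s → ∑[ j < n ] t (j Fin.↑ˡ (m ℕ.* n)) ℤ.+ s) (sum-* m (t ∘ (n Fin.↑ʳ_))))

  sum≡S : ∀ m n (t : Fin (n ℕ.^ m) → ℤ) w →
          (∀ c → t c ≡ w (tabulate (toℕ ∘ finToFun c))) → sum t ≡ S m n w
  sum≡S zero    n t w e = trans (ℤ.+-identityʳ (t zero)) (e zero)
  sum≡S (suc m) n t w e = trans (sum-* n t) (sum-cong-≗ {n} λ a →
    sum≡S m n (t ∘ Fin.combine a) (w ∘ (toℕ a ∷_)) λ c →
      trans (e (Fin.combine a c)) (cong (λ (q , r) → w (toℕ r ∷ tabulate (toℕ ∘ finToFun q)))
        (cong swap (Fin.remQuot-combine a c))))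

  StrictVec : ∀ {k} → FP k → Vec ℕ k → Set
  StrictVec P v = ∀ x y → x < y → lookup v x ℕ.< lookup v y
    where open FP P

  strictVec? : ∀ {k} (P : FP k) v → Dec (StrictVec P v)
  strictVec? P v = Fin.all? λ x → Fin.all? λ y → (x <? y) →-dec (lookup v x ℕ.<? lookup v y)
    where open FP P

  weight : ∀ {k} → FP k → Vec ℕ k → ℤ
  weight P v = + (if does (strictVec? P v) then 1 else 0)

  weight-invariant : ∀ {k} (P : FP k) → Invariant (weight P)
  weight-invariant P φ p v = cong (λ b → + (if b then 1 else 0))
    (does-⇔ (mk⇔
      (λ s x y x<y → Equivalence.from (p _ _) (substAll (lookup-map x φ v) (lookup-map y φ v) (s x y x<y)))
      (λ s x y x<y → substAll (sym (lookup-map x φ v)) (sym (lookup-map y φ v)) (Equivalence.to (p _ _) (s x y x<y))))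
      (strictVec? P (map φ v)) (strictVec? P v))
    where
    substAll : ∀ {a b c e} → a ≡ b → c ≡ e → a ℕ.< c → b ℕ.< e
    substAll refl refl q = q

  Ω°≡S : ∀ {k} (P : FP k) n → + Ω° P n ≡ S k n (weight P)
  Ω°≡S {k} P n = trans (+-sum {n ℕ.^ k} _) (sum≡S k n _ (weight P) λ c →
    cong (λ b → + (if b then 1 else 0)) (does-⇔ (mk⇔
      (λ s x y x<y → substAll (sym (lookup∘tabulate _ x)) (sym (lookup∘tabulate _ y)) (s x y x<y))
      (λ s x y x<y → substAll (lookup∘tabulate _ x) (lookup∘tabulate _ y) (s x y x<y)))
      (strict? P (finToFun c)) (strictVec? P (tabulate (toℕ ∘ finToFun c)))))
    where
    substAll : ∀ {a b c e} → a ≡ b → c ≡ e → a ℕ.< c → b ℕ.< e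
    substAll refl refl q = q

  Ω°0≡0 : ∀ {k} (P : FP k) → Ω° P 0 ≡ 0
  Ω°0≡0 {suc k} P = refl
  Ω°0≡0 {zero}  P with () ← NonZero.nonZero (FP.nonEmpty P)

-- The defining property of the integers d P i.
d-expansion : ∀ {k} (P : FP k) n →
              + Ω° P n ≡ ∑[ i < k ] (d P (suc (toℕ i)) ℤ.* + (n C suc (toℕ i)))
d-expansion {k} P n = begin
  + Ω° P n
    ≡⟨ newton (suc k) F
         (Deg<-resp (suc k) (Ω°≡S P) (S-Deg< (suc k) k (weight P) (ℕ.n<1+n k) (weight-invariant P))) n ⟩
  + Ω° P 0 ℤ.* 1ℤ ℤ.+ ∑[ i < k ] (d P (suc (toℕ i)) ℤ.* + (n C suc (toℕ i)))
    ≡⟨ cong (λ t → + t ℤ.* 1ℤ ℤ.+ rest) (Ω°0≡0 P) ⟩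
  0ℤ ℤ.+ rest
    ≡⟨ ℤ.+-identityˡ rest ⟩
  rest ∎
  where
  open Degree
  open ≡-Reasoning
  F : ℕ → ℤ
  F m = + Ω° P m
  rest : ℤ
  rest = ∑[ i < k ] (d P (suc (toℕ i)) ℤ.* + (n C suc (toℕ i)))

funToFin-cong : ∀ {m n} {f g : Fin m → Fin n} → f ≗ g → funToFin f ≡ funToFin g
funToFin-cong {zero}  e = refl
funToFin-cong {suc m} e = cong₂ Fin.combine (e zero) (funToFin-cong (e ∘ suc))

count-cong : ∀ {m m′ n} {A : (Fin m → Fin n) → Set} {B : (Fin m′ → Fin n) → Set}
             (A? : ∀ f → Dec (A f)) (B? : ∀ g → Dec (B g)) (σ : Fin m ↔ Fin m′) →
             (∀ f g → g ≗ f ∘ Inverse.from σ → A f ⇔ B g) → count A? ≡ count B?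
count-cong {m} {m′} {n} A? B? σ A⇔B = trans
  (sumℕ-cong {n ℕ.^ m} λ c → cong (λ b → if b then 1 else 0)
    (does-⇔ (A⇔B _ _ (Fin.finToFun-funToFin (finToFun c ∘ from))) (A? _) (B? _)))
  (sym (sumℕ-permute _ π))
  where
  open Inverse σ
  π : Fin (n ℕ.^ m) ↔ Fin (n ℕ.^ m′)
  π = mk↔ₛ′ (λ c → funToFin (finToFun c ∘ from)) (λ c → funToFin (finToFun c ∘ to))
    (λ c → trans (funToFin-cong λ i → trans (Fin.finToFun-funToFin (finToFun c ∘ to) (from i))
                                            (cong (finToFun c) (strictlyInverseˡ i)))
                 (Fin.funToFin-finToFin {m′} c))
    (λ c → trans (funToFin-cong λ i → trans (Fin.finToFun-funToFin (finToFun c ∘ from) (to i))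
                                            (cong (finToFun c) (strictlyInverseʳ i)))
                 (Fin.funToFin-finToFin {m} c))

Ω-cong : ∀ {m m′} {P : FP m} {Q : FP m′} → P ≅ Q → ∀ n → Ω P n ≡ Ω Q n
Ω-cong {P = P} {Q} e n = count-cong (weak? P) (weak? Q) points λ f g g≗ → mk⇔
  (λ w x y x≤y → resp (sym (g≗ x)) (sym (g≗ y)) (w _ _ (_≅_.mono (≅-sym e) x≤y)))
  (λ w x y x≤y → resp (trans (g≗ (to x)) (cong f (strictlyInverseʳ x)))
                      (trans (g≗ (to y)) (cong f (strictlyInverseʳ y))) (w _ _ (mono x≤y)))
  where
  open _≅_ e
  resp : ∀ {a b c e : Fin n} → a ≡ b → c ≡ e → a Fin.≤ c → b Fin.≤ e
  resp refl refl p = p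

≅-mono-< : ∀ {m n} {P : FP m} {Q : FP n} (e : P ≅ Q) →
           ∀ {x y} → FP._<_ P x y → FP._<_ Q (_≅_.to e x) (_≅_.to e y)
≅-mono-< e (x≤y , x≢y) = mono x≤y , λ eq →
  x≢y (trans (sym (strictlyInverseʳ _)) (trans (cong from eq) (strictlyInverseʳ _)))
  where open _≅_ e

Ω°-cong : ∀ {m m′} {P : FP m} {Q : FP m′} → P ≅ Q → ∀ n → Ω° P n ≡ Ω° Q n
Ω°-cong {P = P} {Q} e n = count-cong (strict? P) (strict? Q) points λ f g g≗ → mk⇔
  (λ w x y x<y → resp (sym (g≗ x)) (sym (g≗ y)) (w _ _ (≅-mono-< (≅-sym e) x<y)))
  (λ w x y x<y → resp (trans (g≗ (to x)) (cong f (strictlyInverseʳ x)))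
                      (trans (g≗ (to y)) (cong f (strictlyInverseʳ y))) (w _ _ (≅-mono-< e x<y)))
  where
  open _≅_ e
  resp : ∀ {a b c e : Fin n} → a ≡ b → c ≡ e → a Fin.< c → b Fin.< e
  resp refl refl p = p

-- Formal power series, as their coefficient sequences.
Series : Set
Series = ℕ → ℤ

infixl 7 _⊛_
_⊛_ : Series → Series → Series
(f ⊛ g) n = ∑[ i < suc n ] (f (toℕ i) ℤ.* g (n ℕ.∸ toℕ i))

one : Series
one zero    = 1ℤ
one (suc _) = 0ℤ

infixr 8 _^ˢ_
_^ˢ_ : Series → ℕ → Series
f ^ˢ zero  = one
f ^ˢ suc k = f ⊛ (f ^ˢ k)

X : Series
X 1 = 1ℤ
X _ = 0ℤ

1-X : Series
1-X n = one n ℤ.- X n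

[1-X]⁻¹ : Series
[1-X]⁻¹ _ = 1ℤ

[1-X]⁻¹-inverse : 1-X ⊛ [1-X]⁻¹ ≗ one
[1-X]⁻¹-inverse zero    = refl
[1-X]⁻¹-inverse (suc n) = cong (λ s → 1ℤ ℤ.+ (-1ℤ ℤ.+ s)) (sum-replicate-zero n)

-- Only the indices k ≥ 1 are used.
basis⁺ : ℕ → Series
basis⁺ k = X ⊛ [1-X]⁻¹ ^ˢ suc k

basisˢ : ℕ → Series
basisˢ k = X ⊛ 1-X ^ˢ (k ℕ.∸ 1)

𝔷⁺ : ∀ {k} → FP k → Series
𝔷⁺ P zero    = 0ℤ
𝔷⁺ P (suc n) = + Ω P (suc n)

𝔷ˢ : ∀ {k} → FP k → Series
𝔷ˢ {k} P n = ∑[ j < k ] (let i = suc (toℕ j) in -1ℤ ℤ.^ (k ℕ.∸ i) ℤ.* d P i ℤ.* basisˢ i n)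

𝔷⁺-cong : ∀ {m n} {P : FP m} {Q : FP n} → P ≅ Q → 𝔷⁺ P ≗ 𝔷⁺ Q
𝔷⁺-cong e zero    = refl
𝔷⁺-cong e (suc n) = cong +_ (Ω-cong e (suc n))

≅-size : ∀ {m n} {P : FP m} {Q : FP n} → P ≅ Q → m ≡ n
≅-size e = ↔⇒≡ (_≅_.points e)

𝔷ˢ-cong : ∀ {m n} {P : FP m} {Q : FP n} → P ≅ Q → 𝔷ˢ P ≗ 𝔷ˢ Q
𝔷ˢ-cong {m} e l with refl ← ≅-size e = sum-cong-≗ {m} λ j →
  let i = suc (toℕ j) in
  cong (λ c → -1ℤ ℤ.^ (m ℕ.∸ i) ℤ.* c ℤ.* basisˢ i l)
    (Degree.Δ-cong i (λ n → cong +_ (Ω°-cong e n)) 0)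

-- An isomorphism only involves the operations, so the unit, associativity and
-- equivariance laws are not recorded.
record FPAlgebra : Set₂ where
  field
    setoid : Setoid (lsuc 0ℓ) 0ℓ
  open Setoid setoid public using (Carrier; _≈_)
  field
    act      : ∀ {k} → FP k → (Fin k → Carrier) → Carrier
    act-cong : ∀ {k} (P : FP k) {u v : Fin k → Carrier} → (∀ i → u i ≈ v i) → act P u ≈ act P v

record Element (Z : ∀ {k} → FP k → Series) : Set₁ where
  field
    {points}   : ℕ
    poset      : FP points
    series     : Series
    producedBy : series ≗ Z poset

-- The points of the poset of an element carry no labels: posets are compared
-- up to isomorphism.
elementSetoid : (∀ {k} → FP k → Series) → Setoid (lsuc 0ℓ) 0ℓ
elementSetoid Z = record
  { Carrier       = Element Z
  ; _≈_           = λ u v → poset u ≅ poset v × series u ≗ series v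
  ; isEquivalence = record
    { refl  = ≅-refl , λ _ → refl
    ; sym   = λ (e , f) → ≅-sym e , λ n → sym (f n)
    ; trans = λ (e , f) (e′ , f′) → ≅-trans e e′ , λ n → trans (f n) (f′ n)
    }
  }
  where open Element

seriesAlgebra : (Z : ∀ {k} → FP k → Series) →
                (∀ {m n} {P : FP m} {Q : FP n} → P ≅ Q → Z P ≗ Z Q) → FPAlgebra
seriesAlgebra Z Z-cong = record
  { setoid   = elementSetoid Z
  ; act      = λ P u → record
    { poset      = lexSum P (poset ∘ u)
    ; series     = Z (lexSum P (poset ∘ u))
    ; producedBy = λ _ → refl
    }
  ; act-cong = λ P u≈v → let e = lexSum-cong P (proj₁ ∘ u≈v) in e , Z-cong e
  }
  where open Element

weakOrderSeries : FPAlgebra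
weakOrderSeries = seriesAlgebra 𝔷⁺ 𝔷⁺-cong

weakSurjectiveOrderSeries : FPAlgebra
weakSurjectiveOrderSeries = seriesAlgebra 𝔷ˢ 𝔷ˢ-cong

record IsOperadicIsomorphism (A B : FPAlgebra)
                             (Φ : FPAlgebra.Carrier A → FPAlgebra.Carrier B) : Set₁ where
  private
    module A = FPAlgebra A
    module B = FPAlgebra B
  field
    isBijection : IsBijection A._≈_ B._≈_ Φ
    commutes    : ∀ {k} (P : FP k) (u : Fin k → A.Carrier) → Φ (A.act P u) B.≈ B.act P (Φ ∘ u)

-- A member of the ℤ-span of b 1, b 2, …, with a chosen expansion.
record Span (b : ℕ → Series) : Set where
  field
    series      : Series
    bound       : ℕ
    coefficient : Fin bound → ℤ
    expansion   : ∀ n → series n ≡ ∑[ j < bound ] (coefficient j ℤ.* b (suc (toℕ j)) n)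

changeOfBasis : Span basis⁺ → Span basisˢ
changeOfBasis s = record
  { series      = λ n → ∑[ j < bound ] (coefficient j ℤ.* basisˢ (suc (toℕ j)) n)
  ; bound       = bound
  ; coefficient = coefficient
  ; expansion   = λ _ → refl
  }
  where open Span s

-- welldefined says that the value does not depend on the chosen expansion.
record IsLinearExtension {b b′ : ℕ → Series} (φ : Span b → Span b′) : Set where
  open Span using (series)
  field
    welldefined : ∀ s t → series s ≗ series t → series (φ s) ≗ series (φ t)
    additive    : ∀ s t u → (∀ n → series u n ≡ series s n ℤ.+ series t n) →
                  ∀ n → series (φ u) n ≡ series (φ s) n ℤ.+ series (φ t) n
    scaling     : ∀ c s t → (∀ n → series t n ≡ c ℤ.* series s n) →
                  ∀ n → series (φ t) n ≡ c ℤ.* series (φ s) n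
    on-basis    : ∀ k → NonZero k → ∀ s → series s ≗ b k → series (φ s) ≗ b′ k

_InducedBy_ : (Element 𝔷⁺ → Element 𝔷ˢ) → (Span basis⁺ → Span basisˢ) → Set₁
Φ InducedBy φ = ∀ u → poset (Φ u) ≅ poset u ×
  Σ[ s ∈ Span basis⁺ ] (Span.series s ≗ series u × series (Φ u) ≗ Span.series (φ s))
  where open Element

{-# OPTIONS --safe #-}
module Submission where

-- Differencing the coefficients shows that the series x/(1-x)^{k+1} are
-- linearly independent, so the change of basis extends linearly; it carries
-- 𝔷⁺ to 𝔷ˢ by the reciprocity (-1)^{|P|} Ω°(P,-n) = Ω(P,n), where Ω°(P,-) is
-- read as a polynomial.  Classify strict maps by the set A of (minimal) points
-- sent to the least value: Ω°(P,n+1) = ∑_A Ω°(P∖A,n).  For weak maps,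
-- inclusion–exclusion over the minimal points sent to the least value gives
-- Ω(P,n) = ∑_A (-1)^{|A|} Ω(P∖A,n+1), which is the same recursion after n ↦ -n-1
-- in the first, so reciprocity follows by induction on |P| and n.
-- Everything else about the isomorphism is immediate, because an element of
-- either algebra is determined by its poset.

open import Defs
open import Data.Product.Base using (Σ-syntax; _×_)

open import Data.Bool.Base using (Bool; true; false; if_then_else_)
open import Data.Bool.Properties using () renaming (_≟_ to _≟ᵇ_)
open import Data.Empty using (⊥-elim)
open import Data.Fin.Base as Fin using (Fin; zero; suc; toℕ; finToFun)
import Data.Fin.Properties as Fin
open import Data.Fin.Induction using (po-wellFounded)
open import Data.Integer.Base as ℤ using (ℤ; +_; 0ℤ; 1ℤ; -1ℤ)
import Data.Integer.Properties as ℤ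
open import Data.Integer.Tactic.RingSolver using (solve-∀)
open import Data.Nat.Base as ℕ using (ℕ; zero; suc)
import Data.Nat.Properties as ℕ
open import Data.Nat.Induction using (<-rec)
open import Data.Product.Base using (∃; _,_; proj₁; proj₂)
open import Data.Sum.Base using (_⊎_; inj₁; inj₂)
open import Data.Vec.Base using (Vec; []; _∷_; lookup; map; tabulate)
open import Data.Vec.Properties using (lookup-map; lookup-replicate; lookup∘tabulate)
open import Function.Base using (_∘_; _on_)
open import Function.Bundles using (_⇔_; mk⇔; Equivalence)
open import Induction.WellFounded using (WellFounded)
import Induction.WellFounded as WF
import Relation.Binary.Construct.On as On
open import Level using (0ℓ)
open import Relation.Binary.Bundles using (Setoid)
open import Relation.Binary.Core using (Rel)
open import Relation.Binary.Definitions using (Decidable)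
open import Relation.Binary.PropositionalEquality
  using (_≡_; refl; sym; trans; cong; cong₂; subst; subst₂; _≗_; module ≡-Reasoning)
open import Relation.Binary.Structures using (IsDecPartialOrder)
open import Relation.Nullary.Decidable
  using (Dec; yes; no; does; does-⇔; _→-dec_; _×-dec_; ¬?; dec-true; dec-false)
open import Relation.Nullary.Negation using (¬_)

open import Algebra.Properties.Semiring.Sum ℤ.+-*-semiring
  using (sum-syntax; sum-cong-≗; ∑-distrib-+; sum-replicate-zero; *-distribˡ-sum)
open import Algebra.Properties.AbelianGroup ℤ.+-0-abelianGroup using (∙-cancelˡ)

open Degree
open ≡-Reasoning

-- Coefficients of the series x/(1-x)^{k+1} and their linear independence.

∑-zero : ∀ {n} {t : Fin n → ℤ} → (∀ i → t i ≡ 0ℤ) → ∑[ i < n ] t i ≡ 0ℤ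
∑-zero {n} e = trans (sum-cong-≗ {n} e) (sum-replicate-zero n)

X-shift : ∀ f n → (X ⊛ f) (suc n) ≡ f n
X-shift f n = begin
  0ℤ ℤ.* f (suc n) ℤ.+ (1ℤ ℤ.* f n ℤ.+ ∑[ i < n ] (0ℤ ℤ.* f (n ℕ.∸ suc (toℕ i))))
    ≡⟨ cong (λ s → 0ℤ ℤ.* f (suc n) ℤ.+ (1ℤ ℤ.* f n ℤ.+ s))
         (∑-zero {n} λ i → ℤ.*-zeroˡ (f (n ℕ.∸ suc (toℕ i)))) ⟩
  0ℤ ℤ.* f (suc n) ℤ.+ (1ℤ ℤ.* f n ℤ.+ 0ℤ)
    ≡⟨ lemma (f (suc n)) (f n) ⟩
  f n ∎
  where
  lemma : ∀ a b → 0ℤ ℤ.* a ℤ.+ (1ℤ ℤ.* b ℤ.+ 0ℤ) ≡ b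
  lemma = solve-∀

basis⁺-0 : ∀ k → basis⁺ k 0 ≡ 0ℤ
basis⁺-0 k = trans (ℤ.+-identityʳ _) (ℤ.*-zeroˡ (([1-X]⁻¹ ^ˢ suc k) 0))

-- The series x/(1-x) is not a member of the basis, but it is where the recursion `basis⁺-pascal`
-- ends.
basis⁺-zero : ∀ n → basis⁺ 0 (suc n) ≡ 1ℤ
basis⁺-zero n = trans (X-shift ([1-X]⁻¹ ^ˢ 1) n) (partialSum n)
  where
  partialSum : ∀ n → ([1-X]⁻¹ ^ˢ 1) n ≡ 1ℤ
  partialSum zero    = refl
  partialSum (suc n) = trans (ℤ.+-identityˡ _) (partialSum n)

-- Multiplication by 1-x cancels one factor of the denominator, so consecutive coefficients differ
-- by a coefficient of the series of index one lower.
basis⁺-pascal : ∀ k n → basis⁺ (suc k) (suc n) ≡ basis⁺ (suc k) n ℤ.+ basis⁺ k (suc n)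
basis⁺-pascal k zero = begin
  basis⁺ (suc k) 1               ≡⟨ X-shift ([1-X]⁻¹ ^ˢ suc (suc k)) 0 ⟩
  1ℤ ℤ.* h 0 ℤ.+ 0ℤ              ≡⟨ lemma (h 0) ⟩
  0ℤ ℤ.+ h 0                     ≡⟨ cong₂ ℤ._+_ (basis⁺-0 (suc k)) (X-shift h 0) ⟨
  basis⁺ (suc k) 0 ℤ.+ basis⁺ k 1 ∎
  where
  h : Series
  h = [1-X]⁻¹ ^ˢ suc k
  lemma : ∀ a → 1ℤ ℤ.* a ℤ.+ 0ℤ ≡ 0ℤ ℤ.+ a
  lemma = solve-∀
basis⁺-pascal k (suc n) = begin
  basis⁺ (suc k) (suc (suc n))                     ≡⟨ X-shift ([1-X]⁻¹ ⊛ h) (suc n) ⟩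
  -- Convolution with the constant sequence 1 is a running sum; its leading term splits off by
  -- computation.
  1ℤ ℤ.* h (suc n) ℤ.+ ([1-X]⁻¹ ⊛ h) n             ≡⟨ lemma (h (suc n)) (([1-X]⁻¹ ⊛ h) n) ⟩
  ([1-X]⁻¹ ⊛ h) n ℤ.+ h (suc n)                    ≡⟨ cong₂ ℤ._+_ (X-shift ([1-X]⁻¹ ⊛ h) n) (X-shift h (suc n)) ⟨
  basis⁺ (suc k) (suc n) ℤ.+ basis⁺ k (suc (suc n)) ∎
  where
  h : Series
  h = [1-X]⁻¹ ^ˢ suc k
  lemma : ∀ a b → 1ℤ ℤ.* a ℤ.+ b ≡ b ℤ.+ a
  lemma = solve-∀

-- Differencing lowers every index by one and turns basis⁺ 1 into a constant;
-- the offset s absorbs the coefficients lost on the way.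
basis⁺-independent : ∀ m s (a : ℤ) (c : Fin m → ℤ) →
  (∀ n → a ℤ.+ ∑[ j < m ] (c j ℤ.* basis⁺ (suc (toℕ j)) (n ℕ.+ s)) ≡ 0ℤ) →
  a ≡ 0ℤ × (∀ j → c j ≡ 0ℤ)
basis⁺-independent zero    s a c e = trans (sym (ℤ.+-identityʳ a)) (e 0) , λ ()
basis⁺-independent (suc m) s a c e = a≡0 , c≡0
  where
  comb : ℕ → ℤ
  comb n = ∑[ j < suc m ] (c j ℤ.* basis⁺ (suc (toℕ j)) n)

  differenced : ∀ n → comb (suc n) ≡ comb n ℤ.+
    (c zero ℤ.+ ∑[ j < m ] (c (suc j) ℤ.* basis⁺ (suc (toℕ j)) (suc n)))
  differenced n = begin
    comb (suc n)
      ≡⟨ sum-cong-≗ {suc m} (λ j → trans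
           (cong (c j ℤ.*_) (basis⁺-pascal (toℕ j) n))
           (ℤ.*-distribˡ-+ (c j) (basis⁺ (suc (toℕ j)) n) (basis⁺ (toℕ j) (suc n)))) ⟩
    ∑[ j < suc m ] (c j ℤ.* basis⁺ (suc (toℕ j)) n ℤ.+ c j ℤ.* basis⁺ (toℕ j) (suc n))
      ≡⟨ ∑-distrib-+ {suc m} (λ j → c j ℤ.* basis⁺ (suc (toℕ j)) n) (λ j → c j ℤ.* basis⁺ (toℕ j) (suc n)) ⟩
    comb n ℤ.+ (c zero ℤ.* basis⁺ 0 (suc n) ℤ.+ rest)
      ≡⟨ cong (λ b → comb n ℤ.+ (b ℤ.+ rest))
           (trans (cong (c zero ℤ.*_) (basis⁺-zero n)) (ℤ.*-identityʳ (c zero))) ⟩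
    comb n ℤ.+ (c zero ℤ.+ rest) ∎
    where
    rest : ℤ
    rest = ∑[ j < m ] (c (suc j) ℤ.* basis⁺ (suc (toℕ j)) (suc n))

  cancel : ∀ a x y → a ℤ.+ x ≡ 0ℤ → a ℤ.+ (x ℤ.+ y) ≡ 0ℤ → y ≡ 0ℤ
  cancel a x y p q = begin
    y                             ≡⟨ lemma a x y ⟩
    (a ℤ.+ (x ℤ.+ y)) ℤ.- (a ℤ.+ x) ≡⟨ cong₂ ℤ._-_ q p ⟩
    0ℤ ∎
    where
    lemma : ∀ a x y → y ≡ (a ℤ.+ (x ℤ.+ y)) ℤ.- (a ℤ.+ x)
    lemma = solve-∀

  -- In the differenced relation `c zero` takes the place of the constant `a`; the relation is
  -- available from argument `suc s` on.
  tail : c zero ≡ 0ℤ × (∀ j → c (suc j) ≡ 0ℤ)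
  tail = basis⁺-independent m (suc s) (c zero) (c ∘ suc) λ n →
    subst (λ l → c zero ℤ.+ ∑[ j < m ] (c (suc j) ℤ.* basis⁺ (suc (toℕ j)) l) ≡ 0ℤ)
      (sym (ℕ.+-suc n s))
      (cancel a (comb (n ℕ.+ s))
        (c zero ℤ.+ ∑[ j < m ] (c (suc j) ℤ.* basis⁺ (suc (toℕ j)) (suc (n ℕ.+ s))))
        (e n)
        (trans (cong (λ s → a ℤ.+ s) (sym (differenced (n ℕ.+ s)))) (e (suc n))))

  c≡0 : ∀ j → c j ≡ 0ℤ
  c≡0 zero    = proj₁ tail
  c≡0 (suc j) = proj₂ tail j

  a≡0 : a ≡ 0ℤ
  a≡0 = begin
    a             ≡⟨ ℤ.+-identityʳ a ⟨
    a ℤ.+ 0ℤ      ≡⟨ cong (λ s → a ℤ.+ s) (∑-zero {suc m} λ j →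
                       trans (cong (ℤ._* basis⁺ (suc (toℕ j)) s) (c≡0 j)) (ℤ.*-zeroˡ (basis⁺ (suc (toℕ j)) s))) ⟨
    a ℤ.+ comb s  ≡⟨ e 0 ⟩
    0ℤ            ∎

-- Linearity of the change of basis.

-- Expansions of different lengths can be compared once they are extended by 0 to a common length.
pad : ∀ {m} → (Fin m → ℤ) → ℕ → ℤ
pad {zero}  c j       = 0ℤ
pad {suc m} c zero    = c zero
pad {suc m} c (suc j) = pad (c ∘ suc) j

∑-pad : ∀ {m N} → m ℕ.≤ N → ∀ c (g : ℕ → ℤ) →
        ∑[ j < m ] (c j ℤ.* g (toℕ j)) ≡ ∑[ j < N ] (pad c (toℕ j) ℤ.* g (toℕ j))
∑-pad {N = N} ℕ.z≤n c g = sym (∑-zero {N} λ j → ℤ.*-zeroˡ (g (toℕ j)))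
∑-pad (ℕ.s≤s m≤N) c g =
  cong (λ s → c zero ℤ.* g 0 ℤ.+ s) (∑-pad m≤N (c ∘ suc) (g ∘ suc))

∑-linear : ∀ N (a b : ℤ) (x y z g : Fin N → ℤ) →
  ∑[ j < N ] ((z j ℤ.- (a ℤ.* x j ℤ.+ b ℤ.* y j)) ℤ.* g j) ≡
  ∑[ j < N ] (z j ℤ.* g j) ℤ.-
    (a ℤ.* ∑[ j < N ] (x j ℤ.* g j) ℤ.+ b ℤ.* ∑[ j < N ] (y j ℤ.* g j))
∑-linear zero    a b x y z g = lemma a b
  where
  lemma : ∀ a b → 0ℤ ≡ 0ℤ ℤ.- (a ℤ.* 0ℤ ℤ.+ b ℤ.* 0ℤ)
  lemma = solve-∀
∑-linear (suc N) a b x y z g = trans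
  (cong (λ s → (z zero ℤ.- (a ℤ.* x zero ℤ.+ b ℤ.* y zero)) ℤ.* g zero ℤ.+ s)
    (∑-linear N a b (x ∘ suc) (y ∘ suc) (z ∘ suc) (g ∘ suc)))
  (lemma a b (x zero) (y zero) (z zero) (g zero) _ _ _)
  where
  lemma : ∀ a b x y z g sx sy sz →
    (z ℤ.- (a ℤ.* x ℤ.+ b ℤ.* y)) ℤ.* g ℤ.+ (sz ℤ.- (a ℤ.* sx ℤ.+ b ℤ.* sy)) ≡
    (z ℤ.* g ℤ.+ sz) ℤ.- (a ℤ.* (x ℤ.* g ℤ.+ sx) ℤ.+ b ℤ.* (y ℤ.* g ℤ.+ sy))
  lemma = solve-∀

-- The hypothesis is a vanishing combination of the series `basis⁺`; by independence all its
-- coefficients are 0, so the same combination of the series `basisˢ` vanishes. Well-definedness (a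
-- = 1, b = 0), additivity (a = b = 1) and scaling (b = 0) are special cases.
changeOfBasis-linear : ∀ a b (s t u : Span basis⁺) →
  (∀ n → Span.series u n ≡ a ℤ.* Span.series s n ℤ.+ b ℤ.* Span.series t n) →
  ∀ n → Span.series (changeOfBasis u) n ≡
        a ℤ.* Span.series (changeOfBasis s) n ℤ.+ b ℤ.* Span.series (changeOfBasis t) n
changeOfBasis-linear a b s t u e n = ℤ.i-j≡0⇒i≡j _ _ (begin
  Span.series (changeOfBasis u) n ℤ.-
    (a ℤ.* Span.series (changeOfBasis s) n ℤ.+ b ℤ.* Span.series (changeOfBasis t) n)
    ≡⟨ combined basisˢ n ⟨
  ∑[ j < N ] (c j ℤ.* basisˢ (suc (toℕ j)) n)
    ≡⟨ ∑-zero {N} (λ j → trans (cong (ℤ._* basisˢ (suc (toℕ j)) n) (c≡0 j)) (ℤ.*-zeroˡ (basisˢ (suc (toℕ j)) n))) ⟩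
  0ℤ ∎)
  where
  open Span using (bound; coefficient)
  N : ℕ
  N = bound s ℕ.+ (bound t ℕ.+ bound u)
  c : Fin N → ℤ
  c j = pad (coefficient u) (toℕ j) ℤ.-
    (a ℤ.* pad (coefficient s) (toℕ j) ℤ.+ b ℤ.* pad (coefficient t) (toℕ j))

  value : (ℕ → Series) → Span basis⁺ → Series
  value g r n = ∑[ j < bound r ] (coefficient r j ℤ.* g (suc (toℕ j)) n)

  -- Read with `basis⁺` this yields the vanishing combination, read with `basisˢ` it transports the
  -- conclusion.
  combined : ∀ g n → ∑[ j < N ] (c j ℤ.* g (suc (toℕ j)) n) ≡
    value g u n ℤ.- (a ℤ.* value g s n ℤ.+ b ℤ.* value g t n)
  combined g n = trans (∑-linear N a b
    (pad (coefficient s) ∘ toℕ) (pad (coefficient t) ∘ toℕ) (pad (coefficient u) ∘ toℕ) (λ j → g (suc (toℕ j)) n))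
    (sym (cong₂ ℤ._-_
      (∑-pad (ℕ.m≤n⇒m≤o+n (bound s) (ℕ.m≤n+m (bound u) (bound t))) (coefficient u) (λ j → g (suc j) n))
      (cong₂ (λ x y → a ℤ.* x ℤ.+ b ℤ.* y)
        (∑-pad (ℕ.m≤m+n (bound s) _) (coefficient s) (λ j → g (suc j) n))
        (∑-pad (ℕ.m≤n⇒m≤o+n (bound s) (ℕ.m≤m+n (bound t) (bound u))) (coefficient t) (λ j → g (suc j) n)))))

  vanishes : ∀ n → 0ℤ ℤ.+ ∑[ j < N ] (c j ℤ.* basis⁺ (suc (toℕ j)) (n ℕ.+ 0)) ≡ 0ℤ
  vanishes n = trans (ℤ.+-identityˡ _) (trans (combined basis⁺ l) (ℤ.i≡j⇒i-j≡0 (begin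
    value basis⁺ u l ≡⟨ Span.expansion u l ⟨
    Span.series u l  ≡⟨ e l ⟩
    a ℤ.* Span.series s l ℤ.+ b ℤ.* Span.series t l
      ≡⟨ cong₂ (λ x y → a ℤ.* x ℤ.+ b ℤ.* y) (Span.expansion s l) (Span.expansion t l) ⟩
    a ℤ.* value basis⁺ s l ℤ.+ b ℤ.* value basis⁺ t l ∎)))
    where
    l : ℕ
    l = n ℕ.+ 0

  c≡0 : ∀ j → c j ≡ 0ℤ
  c≡0 = proj₂ (basis⁺-independent N 0 0ℤ c vanishes)

lastOne : ∀ k → Fin (suc k) → ℤ
lastOne zero    _       = 1ℤ
lastOne (suc k) zero    = 0ℤ
lastOne (suc k) (suc j) = lastOne k j

∑-lastOne : ∀ k (g : ℕ → ℤ) → ∑[ j < suc k ] (lastOne k j ℤ.* g (toℕ j)) ≡ g k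
∑-lastOne zero    g = trans (ℤ.+-identityʳ _) (ℤ.*-identityˡ (g 0))
∑-lastOne (suc k) g = trans
  (cong₂ ℤ._+_ (ℤ.*-zeroˡ (g 0)) (∑-lastOne k (g ∘ suc)))
  (ℤ.+-identityˡ _)

basisVector : ∀ k → Span basis⁺
basisVector k = record
  { series      = basis⁺ (suc k)
  ; bound       = suc k
  ; coefficient = lastOne k
  ; expansion   = λ n → sym (∑-lastOne k (λ j → basis⁺ (suc j) n))
  }

changeOfBasis-isLinearExtension : IsLinearExtension changeOfBasis
changeOfBasis-isLinearExtension = record
  { welldefined = welldefined
  ; additive    = λ s t u e n → trans
      (changeOfBasis-linear 1ℤ 1ℤ s t u (λ l → trans (e l) (sym (ones (series s l) (series t l)))) n)
      (ones (image s n) (image t n))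
  ; scaling     = λ c s t e n → trans
      (changeOfBasis-linear c 0ℤ s s t (λ l → trans (e l) (sym (onlyFirst c (series s l) (series s l)))) n)
      (onlyFirst c (image s n) (image s n))
  ; on-basis    = λ where
      -- By well-definedness the given expansion may be replaced by the one with a single
      -- coefficient 1.
      (suc k) _ s e n → trans (welldefined s (basisVector k) e n) (∑-lastOne k (λ j → basisˢ (suc j) n))
  }
  where
  open Span using (series)
  image : Span basis⁺ → Series
  image = series ∘ changeOfBasis
  ones : ∀ x y → 1ℤ ℤ.* x ℤ.+ 1ℤ ℤ.* y ≡ x ℤ.+ y
  ones = solve-∀
  onlyFirst : ∀ c x y → c ℤ.* x ℤ.+ 0ℤ ℤ.* y ≡ c ℤ.* x
  onlyFirst = solve-∀
  first : ∀ x → 1ℤ ℤ.* x ℤ.+ 0ℤ ℤ.* x ≡ x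
  first = solve-∀
  welldefined : ∀ s t → series s ≗ series t → image s ≗ image t
  welldefined s t e n = trans
    (changeOfBasis-linear 1ℤ 0ℤ t t s (λ l → trans (e l) (sym (first (series t l)))) n)
    (first (image t n))

-- Values of polynomial functions at negative integers.

-- For a polynomial function F of degree less than N, reflect N F n is the value
-- of that polynomial at -n.
reflect : ℕ → (ℕ → ℤ) → ℕ → ℤ
reflect zero    F n       = 0ℤ
reflect (suc N) F zero    = F 0
-- This is ∇F(-n-1) = F(-n) - F(-n-1), solved for F(-n-1).
reflect (suc N) F (suc n) = reflect (suc N) F n ℤ.- reflect N (∇ F) (suc n)

reflect-cong : ∀ N {F G} → F ≗ G → reflect N F ≗ reflect N G
reflect-cong zero    e n       = refl
reflect-cong (suc N) e zero    = e 0
reflect-cong (suc N) e (suc n) = cong₂ ℤ._-_ (reflect-cong (suc N) e n)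
  (reflect-cong N (λ m → cong₂ ℤ._-_ (e (suc m)) (e m)) (suc n))

reflect-+ : ∀ N F G n → reflect N (λ m → F m ℤ.+ G m) n ≡ reflect N F n ℤ.+ reflect N G n
reflect-+ zero    F G n       = refl
reflect-+ (suc N) F G zero    = refl
reflect-+ (suc N) F G (suc n) = trans
  (cong₂ ℤ._-_ (reflect-+ (suc N) F G n) (trans
    (reflect-cong N (λ m → interchange (F (suc m)) (G (suc m)) (F m) (G m)) (suc n))
    (reflect-+ N (∇ F) (∇ G) (suc n))))
  (interchange (reflect (suc N) F n) (reflect (suc N) G n) (reflect N (∇ F) (suc n)) (reflect N (∇ G) (suc n)))
  where
  interchange : ∀ a b c e → (a ℤ.+ b) ℤ.- (c ℤ.+ e) ≡ (a ℤ.- c) ℤ.+ (b ℤ.- e)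
  interchange = solve-∀

reflect-* : ∀ N c F n → reflect N (λ m → c ℤ.* F m) n ≡ c ℤ.* reflect N F n
reflect-* zero    c F n       = sym (ℤ.*-zeroʳ c)
reflect-* (suc N) c F zero    = refl
reflect-* (suc N) c F (suc n) = trans
  (cong₂ ℤ._-_ (reflect-* (suc N) c F n) (trans
    (reflect-cong N (λ m → factor c (F (suc m)) (F m)) (suc n))
    (reflect-* N c (∇ F) (suc n))))
  (factor c (reflect (suc N) F n) (reflect N (∇ F) (suc n)))
  where
  factor : ∀ c a b → c ℤ.* a ℤ.- c ℤ.* b ≡ c ℤ.* (a ℤ.- b)
  factor = solve-∀

reflect-ΣMask : ∀ N m (h : ℕ → Vec Bool m → ℤ) n →
                reflect N (λ l → ΣMask m (h l)) n ≡ ΣMask m (λ μ → reflect N (λ l → h l μ) n)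
reflect-ΣMask N zero    h n = refl
reflect-ΣMask N (suc m) h n = trans (reflect-+ N _ (λ l → ΣMask m (h l ∘ (true ∷_))) n)
  (cong₂ ℤ._+_ (reflect-ΣMask N m (λ l → h l ∘ (false ∷_)) n)
               (reflect-ΣMask N m (λ l → h l ∘ (true ∷_)) n))

-- With a larger bound the recursion only descends one difference further, to one that is 0 by
-- `Deg<`.
reflect-stable : ∀ N F → Deg< N F → reflect (suc N) F ≗ reflect N F
reflect-stable zero    F p zero    = p 0
reflect-stable zero    F p (suc n) = trans (ℤ.+-identityʳ _) (reflect-stable zero F p n)
reflect-stable (suc N) F p zero    = refl
reflect-stable (suc N) F p (suc n) =
  cong₂ ℤ._-_ (reflect-stable (suc N) F p n) (reflect-stable N (∇ F) p (suc n))

-- Since F(x+1) = F(x) + ∇F(x), the recursion of `reflect` cancels the ∇F term, once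
-- `reflect-stable` has lowered the bound with which that term is reflected.
reflect-shift : ∀ N F → Deg< N F → ∀ n → reflect N (F ∘ suc) (suc n) ≡ reflect N F n
reflect-shift zero    F p n = refl
reflect-shift (suc N) F p n = begin
  reflect (suc N) (F ∘ suc) (suc n)
    ≡⟨ reflect-cong (suc N) (λ m → split-∇ (F (suc m)) (F m)) (suc n) ⟩
  reflect (suc N) (λ m → F m ℤ.+ ∇ F m) (suc n)
    ≡⟨ reflect-+ (suc N) F (∇ F) (suc n) ⟩
  (reflect (suc N) F n ℤ.- reflect N (∇ F) (suc n)) ℤ.+ reflect (suc N) (∇ F) (suc n)
    ≡⟨ cong (λ s → (reflect (suc N) F n ℤ.- reflect N (∇ F) (suc n)) ℤ.+ s) (reflect-stable N (∇ F) p (suc n)) ⟩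
  (reflect (suc N) F n ℤ.- reflect N (∇ F) (suc n)) ℤ.+ reflect N (∇ F) (suc n)
    ≡⟨ cancel (reflect (suc N) F n) (reflect N (∇ F) (suc n)) ⟩
  reflect (suc N) F n ∎
  where
  split-∇ : ∀ a b → a ≡ b ℤ.+ (a ℤ.- b)
  split-∇ = solve-∀
  cancel : ∀ a b → (a ℤ.- b) ℤ.+ b ≡ a
  cancel = solve-∀

-- Newton's formula, truncated to N terms, at a negative argument: binom(-n,i) = (-1)^i
-- binom(n+i-1,i), and the last binomial is the coefficient of x^n in x/(1-x)^{i+1}. The proof
-- avoids binomials and matches the recursion of `reflect` with `basis⁺-pascal`.
reflect-newton : ∀ N F n → reflect N F (suc n) ≡
  ∑[ i < N ] (-1ℤ ℤ.^ toℕ i ℤ.* Δ (toℕ i) F 0 ℤ.* basis⁺ (toℕ i) (suc n))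
reflect-newton zero    F n = refl
reflect-newton (suc N) F n = begin
  reflect (suc N) F n ℤ.- reflect N (∇ F) (suc n)
    ≡⟨ cong (λ s → reflect (suc N) F n ℤ.- s) (reflect-newton N (∇ F) n) ⟩
  reflect (suc N) F n ℤ.- ∑[ i < N ] g i
    ≡⟨ step n ⟩
  1ℤ ℤ.* F 0 ℤ.* basis⁺ 0 (suc n) ℤ.+
    ∑[ i < N ] (-1ℤ ℤ.^ suc (toℕ i) ℤ.* c i ℤ.* basis⁺ (suc (toℕ i)) (suc n)) ∎
  where
  c : Fin N → ℤ
  c i = Δ (suc (toℕ i)) F 0
  g : Fin N → ℤ
  g i = -1ℤ ℤ.^ toℕ i ℤ.* c i ℤ.* basis⁺ (toℕ i) (suc n)

  ∑-difference : ∀ N (x y : Fin N → ℤ) →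
    ∑[ i < N ] x i ℤ.- ∑[ i < N ] y i ≡ ∑[ i < N ] (x i ℤ.- y i)
  ∑-difference zero    x y = refl
  ∑-difference (suc N) x y = trans
    (interchange (x zero) (∑[ i < N ] x (suc i)) (y zero) (∑[ i < N ] y (suc i)))
    (cong (λ s → (x zero ℤ.- y zero) ℤ.+ s) (∑-difference N (x ∘ suc) (y ∘ suc)))
    where
    interchange : ∀ a b c e → (a ℤ.+ b) ℤ.- (c ℤ.+ e) ≡ (a ℤ.- c) ℤ.+ (b ℤ.- e)
    interchange = solve-∀

  pascal : ∀ n i → -1ℤ ℤ.^ suc (toℕ i) ℤ.* c i ℤ.* basis⁺ (suc (toℕ i)) (suc n) ≡
    -1ℤ ℤ.^ suc (toℕ i) ℤ.* c i ℤ.* basis⁺ (suc (toℕ i)) n ℤ.-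
    -1ℤ ℤ.^ toℕ i ℤ.* c i ℤ.* basis⁺ (toℕ i) (suc n)
  pascal n i = trans (cong (λ b → -1ℤ ℤ.^ suc (toℕ i) ℤ.* c i ℤ.* b) (basis⁺-pascal (toℕ i) n))
    (lemma (-1ℤ ℤ.^ toℕ i) (c i) (basis⁺ (suc (toℕ i)) n) (basis⁺ (toℕ i) (suc n)))
    where
    lemma : ∀ s c a b → -1ℤ ℤ.* s ℤ.* c ℤ.* (a ℤ.+ b) ≡ -1ℤ ℤ.* s ℤ.* c ℤ.* a ℤ.- s ℤ.* c ℤ.* b
    lemma = solve-∀

  step : ∀ n → reflect (suc N) F n ℤ.- ∑[ i < N ] (-1ℤ ℤ.^ toℕ i ℤ.* c i ℤ.* basis⁺ (toℕ i) (suc n)) ≡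
    1ℤ ℤ.* F 0 ℤ.* basis⁺ 0 (suc n) ℤ.+
    ∑[ i < N ] (-1ℤ ℤ.^ suc (toℕ i) ℤ.* c i ℤ.* basis⁺ (suc (toℕ i)) (suc n))
  step zero = begin
    F 0 ℤ.- ∑[ i < N ] y i
      ≡⟨ lemma (F 0) (∑[ i < N ] y i) ⟩
    1ℤ ℤ.* F 0 ℤ.* 1ℤ ℤ.+ (0ℤ ℤ.- ∑[ i < N ] y i)
      ≡⟨ cong₂ (λ b s → 1ℤ ℤ.* F 0 ℤ.* b ℤ.+ (s ℤ.- ∑[ i < N ] y i)) (basis⁺-zero 0)
           (∑-zero {N} λ i → trans (cong (λ b → -1ℤ ℤ.^ suc (toℕ i) ℤ.* c i ℤ.* b) (basis⁺-0 (suc (toℕ i))))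
                                   (ℤ.*-zeroʳ (-1ℤ ℤ.^ suc (toℕ i) ℤ.* c i))) ⟨
    1ℤ ℤ.* F 0 ℤ.* basis⁺ 0 1 ℤ.+ (∑[ i < N ] x i ℤ.- ∑[ i < N ] y i)
      ≡⟨ cong (λ s → 1ℤ ℤ.* F 0 ℤ.* basis⁺ 0 1 ℤ.+ s)
           (trans (∑-difference N x y) (sum-cong-≗ {N} (sym ∘ pascal 0))) ⟩
    1ℤ ℤ.* F 0 ℤ.* basis⁺ 0 1 ℤ.+
      ∑[ i < N ] (-1ℤ ℤ.^ suc (toℕ i) ℤ.* c i ℤ.* basis⁺ (suc (toℕ i)) 1) ∎
    where
    x y : Fin N → ℤ
    x i = -1ℤ ℤ.^ suc (toℕ i) ℤ.* c i ℤ.* basis⁺ (suc (toℕ i)) 0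
    y i = -1ℤ ℤ.^ toℕ i ℤ.* c i ℤ.* basis⁺ (toℕ i) 1
    lemma : ∀ a b → a ℤ.- b ≡ 1ℤ ℤ.* a ℤ.* 1ℤ ℤ.+ (0ℤ ℤ.- b)
    lemma = solve-∀
  step (suc n) = begin
    reflect (suc N) F (suc n) ℤ.- ∑[ i < N ] y i
      ≡⟨ cong (ℤ._- ∑[ i < N ] y i) (reflect-newton (suc N) F n) ⟩
    (1ℤ ℤ.* F 0 ℤ.* basis⁺ 0 (suc n) ℤ.+ ∑[ i < N ] x i) ℤ.- ∑[ i < N ] y i
      ≡⟨ lemma (1ℤ ℤ.* F 0 ℤ.* basis⁺ 0 (suc n)) (∑[ i < N ] x i) (∑[ i < N ] y i) ⟩
    1ℤ ℤ.* F 0 ℤ.* basis⁺ 0 (suc n) ℤ.+ (∑[ i < N ] x i ℤ.- ∑[ i < N ] y i)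
      ≡⟨ cong₂ (λ b s → 1ℤ ℤ.* F 0 ℤ.* b ℤ.+ s)
           (trans (basis⁺-zero n) (sym (basis⁺-zero (suc n))))
           (trans (∑-difference N x y) (sum-cong-≗ {N} (sym ∘ pascal (suc n)))) ⟩
    1ℤ ℤ.* F 0 ℤ.* basis⁺ 0 (suc (suc n)) ℤ.+
      ∑[ i < N ] (-1ℤ ℤ.^ suc (toℕ i) ℤ.* c i ℤ.* basis⁺ (suc (toℕ i)) (suc (suc n))) ∎
    where
    x y : Fin N → ℤ
    x i = -1ℤ ℤ.^ suc (toℕ i) ℤ.* c i ℤ.* basis⁺ (suc (toℕ i)) (suc n)
    y i = -1ℤ ℤ.^ toℕ i ℤ.* c i ℤ.* basis⁺ (toℕ i) (suc (suc n))
    lemma : ∀ a b c → (a ℤ.+ b) ℤ.- c ≡ a ℤ.+ (b ℤ.- c)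
    lemma = solve-∀

-- Signed sums over subsets, indicators and inclusion-exclusion.

-- This is (-1)^|A|, where A is the set of points marked `false`, those to be sent to the least
-- value.
sign : ∀ {m} → Vec Bool m → ℤ
sign []          = 1ℤ
sign (false ∷ μ) = -1ℤ ℤ.* sign μ
sign (true  ∷ μ) = sign μ

sign-size : ∀ {m} (μ : Vec Bool m) → sign μ ℤ.* -1ℤ ℤ.^ size μ ≡ -1ℤ ℤ.^ m
sign-size []          = refl
sign-size (false ∷ μ) = trans (ℤ.*-assoc -1ℤ (sign μ) (-1ℤ ℤ.^ size μ)) (cong (-1ℤ ℤ.*_) (sign-size μ))
sign-size (true  ∷ μ) = trans (lemma (sign μ) (-1ℤ ℤ.^ size μ)) (cong (-1ℤ ℤ.*_) (sign-size μ))
  where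
  lemma : ∀ a b → a ℤ.* (-1ℤ ℤ.* b) ≡ -1ℤ ℤ.* (a ℤ.* b)
  lemma = solve-∀

sign-full : ∀ m → sign (full m) ≡ 1ℤ
sign-full zero    = refl
sign-full (suc m) = sign-full m

ΣMask-cong : ∀ m {h g} → h ≗ g → ΣMask m h ≡ ΣMask m g
ΣMask-cong zero    e = e []
ΣMask-cong (suc m) e = cong₂ ℤ._+_ (ΣMask-cong m (e ∘ (false ∷_))) (ΣMask-cong m (e ∘ (true ∷_)))

ΣMask-* : ∀ m c h → c ℤ.* ΣMask m h ≡ ΣMask m (λ μ → c ℤ.* h μ)
ΣMask-* zero    c h = refl
ΣMask-* (suc m) c h = trans (ℤ.*-distribˡ-+ c _ _)
  (cong₂ ℤ._+_ (ΣMask-* m c (h ∘ (false ∷_))) (ΣMask-* m c (h ∘ (true ∷_))))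

ΣProper-cong : ∀ m {h g} → (∀ μ → size μ ℕ.< m → h μ ≡ g μ) → ΣProper m h ≡ ΣProper m g
ΣProper-cong zero    e = refl
ΣProper-cong (suc m) e = cong₂ ℤ._+_
  (ΣMask-cong m (λ μ → e (false ∷ μ) (ℕ.s≤s (size≤ μ))))
  (ΣProper-cong m (λ μ q → e (true ∷ μ) (ℕ.s<s q)))

-- Subtracting the terms for proper subsets leaves the term for all points; in this way a recursion
-- over subsets is solved for the one unknown term.
ΣMask-cancel : ∀ m {h g} → ΣMask m h ≡ ΣMask m g → (∀ μ → size μ ℕ.< m → h μ ≡ g μ) →
               h (full m) ≡ g (full m)
ΣMask-cancel m {h} {g} e p = ∙-cancelˡ (ΣProper m h) (h (full m)) (g (full m)) (begin
  ΣProper m h ℤ.+ h (full m) ≡⟨ ΣMask-full m h ⟨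
  ΣMask m h                  ≡⟨ e ⟩
  ΣMask m g                  ≡⟨ ΣMask-full m g ⟩
  ΣProper m g ℤ.+ g (full m) ≡⟨ cong (ℤ._+ g (full m)) (ΣProper-cong m p) ⟨
  ΣProper m h ℤ.+ g (full m) ∎)

S-zero : ∀ m n → S m n (λ _ → 0ℤ) ≡ 0ℤ
S-zero zero    n = refl
S-zero (suc m) n = ∑-zero {n} λ _ → S-zero m n

S-* : ∀ m n c w → c ℤ.* S m n w ≡ S m n (λ v → c ℤ.* w v)
S-* zero    n c w = refl
S-* (suc m) n c w = trans (*-distribˡ-sum {n} c (λ a → S m n (w ∘ (toℕ a ∷_))))
  (sum-cong-≗ {n} λ a → S-* m n c (w ∘ (toℕ a ∷_)))

ΣMask-S : ∀ m k n (w : Vec Bool m → Vec ℕ k → ℤ) →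
          ΣMask m (λ μ → S k n (w μ)) ≡ S k n (λ v → ΣMask m (λ μ → w μ v))
ΣMask-S m zero    n w = refl
ΣMask-S m (suc k) n w = trans
  (sym (ΣMask-∑ m n (λ a μ → S k n (w μ ∘ (toℕ a ∷_)))))
  (sum-cong-≗ {n} λ a → ΣMask-S m k n (λ μ → w μ ∘ (toℕ a ∷_)))

𝟙 : ∀ {A : Set} → Dec A → ℤ
𝟙 A? = + (if does A? then 1 else 0)

𝟙-⇔ : ∀ {A B : Set} → A ⇔ B → (A? : Dec A) (B? : Dec B) → 𝟙 A? ≡ 𝟙 B?
𝟙-⇔ A⇔B A? B? = cong (λ b → + (if b then 1 else 0)) (does-⇔ A⇔B A? B?)

𝟙-yes : ∀ {A : Set} (A? : Dec A) → A → 𝟙 A? ≡ 1ℤ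
𝟙-yes A? a = cong (λ b → + (if b then 1 else 0)) (dec-true A? a)

𝟙-no : ∀ {A : Set} (A? : Dec A) → ¬ A → 𝟙 A? ≡ 0ℤ
𝟙-no A? ¬a = cong (λ b → + (if b then 1 else 0)) (dec-false A? ¬a)

𝟙-× : ∀ {A B : Set} (A? : Dec A) (B? : Dec B) → 𝟙 (A? ×-dec B?) ≡ 𝟙 A? ℤ.* 𝟙 B?
𝟙-× A? B? with does A? | does B?
... | false | _     = refl
... | true  | false = refl
... | true  | true  = refl

-- Lets a fact that depends on A be used next to the indicator of A: if A fails, both products are
-- 0.
𝟙-guard : ∀ {A : Set} (A? : Dec A) {x y} → (A → x ≡ y) → 𝟙 A? ℤ.* x ≡ 𝟙 A? ℤ.* y
𝟙-guard (yes a)        e = cong (1ℤ ℤ.*_) (e a)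
𝟙-guard (no _) {x} {y} e = trans (ℤ.*-zeroˡ x) (sym (ℤ.*-zeroˡ y))

𝟙-∀-suc : ∀ {m} {Q : Fin (suc m) → Set} (Q? : ∀ x → Dec (Q x)) →
          𝟙 (Fin.all? Q?) ≡ 𝟙 (Q? zero) ℤ.* 𝟙 (Fin.all? (Q? ∘ suc))
𝟙-∀-suc Q? = trans
  (𝟙-⇔ (mk⇔ (λ q → q zero , q ∘ suc) (λ (q₀ , q) → Fin.∀-cons q₀ q))
    (Fin.all? Q?) (Q? zero ×-dec Fin.all? (Q? ∘ suc)))
  (𝟙-× (Q? zero) (Fin.all? (Q? ∘ suc)))

Off : ∀ {m} → (Fin m → Set) → Vec Bool m → Set
Off Q μ = ∀ x → lookup μ x ≡ false → Q x

off? : ∀ {m} {Q : Fin m → Set} → (∀ x → Dec (Q x)) → ∀ μ → Dec (Off Q μ)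
off? Q? μ = Fin.all? λ x → (lookup μ x ≟ᵇ false) →-dec Q? x

-- Expanding the product over all points x of 1 - 𝟙 (Q x).
inclusion-exclusion : ∀ m {Q : Fin m → Set} (Q? : ∀ x → Dec (Q x)) →
  ΣMask m (λ μ → sign μ ℤ.* 𝟙 (off? Q? μ)) ≡ 𝟙 (Fin.all? (¬? ∘ Q?))
inclusion-exclusion zero    Q? = refl
inclusion-exclusion (suc m) {Q} Q? = begin
  ΣMask m (λ μ → -1ℤ ℤ.* sign μ ℤ.* 𝟙 (off? Q? (false ∷ μ))) ℤ.+
  ΣMask m (λ μ → sign μ ℤ.* 𝟙 (off? Q? (true ∷ μ)))
    ≡⟨ cong₂ ℤ._+_ (ΣMask-cong m offFalse) (ΣMask-cong m offTrue) ⟩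
  ΣMask m (λ μ → (-1ℤ ℤ.* q₀) ℤ.* g μ) ℤ.+ ΣMask m g
    ≡⟨ cong (ℤ._+ ΣMask m g) (ΣMask-* m (-1ℤ ℤ.* q₀) g) ⟨
  (-1ℤ ℤ.* q₀) ℤ.* ΣMask m g ℤ.+ ΣMask m g
    ≡⟨ lemma q₀ (ΣMask m g) ⟩
  (1ℤ ℤ.- q₀) ℤ.* ΣMask m g
    ≡⟨ cong₂ ℤ._*_ (complement (Q? zero)) (inclusion-exclusion m (Q? ∘ suc)) ⟩
  𝟙 (¬? (Q? zero)) ℤ.* 𝟙 (Fin.all? (¬? ∘ Q? ∘ suc))
    ≡⟨ 𝟙-∀-suc (¬? ∘ Q?) ⟨
  𝟙 (Fin.all? (¬? ∘ Q?)) ∎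
  where
  q₀ : ℤ
  q₀ = 𝟙 (Q? zero)
  g : Vec Bool m → ℤ
  g μ = sign μ ℤ.* 𝟙 (off? (Q? ∘ suc) μ)
  lemma : ∀ a b → (-1ℤ ℤ.* a) ℤ.* b ℤ.+ b ≡ (1ℤ ℤ.- a) ℤ.* b
  lemma = solve-∀
  complement : ∀ {A : Set} (A? : Dec A) → 1ℤ ℤ.- 𝟙 A? ≡ 𝟙 (¬? A?)
  complement (yes _) = refl
  complement (no _)  = refl
  offFalse : ∀ μ → -1ℤ ℤ.* sign μ ℤ.* 𝟙 (off? Q? (false ∷ μ)) ≡ (-1ℤ ℤ.* q₀) ℤ.* g μ
  offFalse μ = trans
    (cong (-1ℤ ℤ.* sign μ ℤ.*_) (trans
      (𝟙-⇔ (mk⇔ (λ o → o zero refl , o ∘ suc) (λ (q , o) → Fin.∀-cons (λ _ → q) o))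
        (off? Q? (false ∷ μ)) (Q? zero ×-dec off? (Q? ∘ suc) μ))
      (𝟙-× (Q? zero) (off? (Q? ∘ suc) μ))))
    (rearrange (sign μ) q₀ (𝟙 (off? (Q? ∘ suc) μ)))
    where
    rearrange : ∀ s a b → -1ℤ ℤ.* s ℤ.* (a ℤ.* b) ≡ (-1ℤ ℤ.* a) ℤ.* (s ℤ.* b)
    rearrange = solve-∀
  offTrue : ∀ μ → sign μ ℤ.* 𝟙 (off? Q? (true ∷ μ)) ≡ g μ
  offTrue μ = cong (sign μ ℤ.*_)
    (𝟙-⇔ (mk⇔ (_∘ suc) (Fin.∀-cons (λ ()))) (off? Q? (true ∷ μ)) (off? (Q? ∘ suc) μ))

-- Sums over vectors with prescribed zeros.

-- Unlike glue, this keeps the entries of u unshifted.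
fill : ∀ {m} (μ : Vec Bool m) → Vec ℕ (size μ) → Vec ℕ m
fill μ u = map ℕ.pred (glue μ u)

Vanish : ∀ {m} → Vec ℕ m → Fin m → Set
Vanish v x = lookup v x ≡ 0

vanish? : ∀ {m} (v : Vec ℕ m) x → Dec (Vanish v x)
vanish? v x = lookup v x ℕ.≟ 0

-- Extension by 0 is a bijection onto the vectors that vanish off the mask. The bound is `suc n`
-- because 0 must be an admissible entry.
S-fill : ∀ {m} (μ : Vec Bool m) n w →
  S (size μ) (suc n) (w ∘ fill μ) ≡ S m (suc n) (λ v → w v ℤ.* 𝟙 (off? (vanish? v) μ))
S-fill []          n w = sym (ℤ.*-identityʳ (w []))
S-fill {suc m} (false ∷ μ) n w = begin
  S (size μ) (suc n) (w ∘ (0 ∷_) ∘ fill μ)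
    ≡⟨ S-fill μ n (w ∘ (0 ∷_)) ⟩
  S m (suc n) (λ v → w (0 ∷ v) ℤ.* 𝟙 (off? (vanish? v) μ))
    ≡⟨ S-cong m (suc n) (λ v → cong (w (0 ∷ v) ℤ.*_)
         (𝟙-⇔ (mk⇔ (Fin.∀-cons (λ _ → refl)) (_∘ suc)) (off? (vanish? v) μ) (off? (vanish? (0 ∷ v)) (false ∷ μ)))) ⟩
  here
    ≡⟨ ℤ.+-identityʳ here ⟨
  here ℤ.+ 0ℤ
    ≡⟨ cong (λ s → here ℤ.+ s) (∑-zero {n} λ a → trans (S-cong m (suc n) λ v →
         trans (cong (w (suc (toℕ a) ∷ v) ℤ.*_)
           (𝟙-no (off? (vanish? (suc (toℕ a) ∷ v)) (false ∷ μ)) λ o → ℕ.1+n≢0 (o zero refl)))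
           (ℤ.*-zeroʳ (w (suc (toℕ a) ∷ v))))
         (S-zero m (suc n))) ⟨
  S (suc m) (suc n) (λ v → w v ℤ.* 𝟙 (off? (vanish? v) (false ∷ μ))) ∎
  where
  here : ℤ
  here = S m (suc n) (λ v → w (0 ∷ v) ℤ.* 𝟙 (off? (vanish? (0 ∷ v)) (false ∷ μ)))
S-fill {suc m} (true ∷ μ) n w = sum-cong-≗ {suc n} λ a → trans
  (S-fill μ n (w ∘ (toℕ a ∷_)))
  (S-cong m (suc n) λ v → cong (w (toℕ a ∷ v) ℤ.*_)
    (𝟙-⇔ (mk⇔ (Fin.∀-cons (λ ())) (_∘ suc)) (off? (vanish? v) μ) (off? (vanish? (toℕ a ∷ v)) (true ∷ μ))))

S-fill-full : ∀ m n w → S (size (full m)) n (w ∘ fill (full m)) ≡ S m n w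
S-fill-full zero    n w = refl
S-fill-full (suc m) n w = sum-cong-≗ {n} λ a → S-fill-full m n (w ∘ (toℕ a ∷_))

nowhereVanishing? : ∀ {m} (v : Vec ℕ m) → Dec (∀ x → ¬ Vanish v x)
nowhereVanishing? v = Fin.all? (¬? ∘ vanish? v)

-- Subtracting 1 from every entry identifies the vectors counted on the left with all vectors below
-- `n`.
S-nowhereVanishing : ∀ m n w →
  S m (suc n) (λ v → w v ℤ.* 𝟙 (nowhereVanishing? v)) ≡ S m n (w ∘ map suc)
S-nowhereVanishing zero    n w = ℤ.*-identityʳ (w [])
S-nowhereVanishing (suc m) n w = trans
  (cong₂ ℤ._+_
    (trans (S-cong m (suc n) λ v → trans
             (cong (w (0 ∷ v) ℤ.*_) (𝟙-no (nowhereVanishing? (0 ∷ v)) λ p → p zero refl))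
             (ℤ.*-zeroʳ (w (0 ∷ v))))
           (S-zero m (suc n)))
    (sum-cong-≗ {n} λ a → trans
      (S-cong m (suc n) λ v → cong (w (suc (toℕ a) ∷ v) ℤ.*_)
        (𝟙-⇔ (mk⇔ (_∘ suc) (Fin.∀-cons (λ ()))) (nowhereVanishing? (suc (toℕ a) ∷ v)) (nowhereVanishing? v)))
      (S-nowhereVanishing m n (w ∘ (suc (toℕ a) ∷_)))))
  (ℤ.+-identityˡ _)

-- Restriction of strict and weak maps to a subset of the points.

embed : ∀ {m} (μ : Vec Bool m) → Fin (size μ) → Fin m
embed (false ∷ μ) i       = suc (embed μ i)
embed (true  ∷ μ) zero    = zero
embed (true  ∷ μ) (suc i) = suc (embed μ i)

embed-view : ∀ {m} (μ : Vec Bool m) x → lookup μ x ≡ false ⊎ ∃ λ i → embed μ i ≡ x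
embed-view (false ∷ μ) zero = inj₁ refl
embed-view (true  ∷ μ) zero = inj₂ (zero , refl)
embed-view (b ∷ μ) (suc x) with b | embed-view μ x
... | _     | inj₁ off        = inj₁ off
... | false | inj₂ (i , refl) = inj₂ (i , refl)
... | true  | inj₂ (i , refl) = inj₂ (suc i , refl)

lookup-glue-off : ∀ {m} (μ : Vec Bool m) u x → lookup μ x ≡ false → lookup (glue μ u) x ≡ 0
lookup-glue-off (false ∷ μ) u       zero    _ = refl
lookup-glue-off (false ∷ μ) u       (suc x) p = lookup-glue-off μ u x p
lookup-glue-off (true  ∷ μ) (_ ∷ u) (suc x) p = lookup-glue-off μ u x p

lookup-glue-embed : ∀ {m} (μ : Vec Bool m) u i → lookup (glue μ u) (embed μ i) ≡ suc (lookup u i)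
lookup-glue-embed (false ∷ μ) u       i       = lookup-glue-embed μ u i
lookup-glue-embed (true  ∷ μ) (_ ∷ u) zero    = refl
lookup-glue-embed (true  ∷ μ) (_ ∷ u) (suc i) = lookup-glue-embed μ u i

lookup-fill-off : ∀ {m} (μ : Vec Bool m) u x → lookup μ x ≡ false → lookup (fill μ u) x ≡ 0
lookup-fill-off μ u x p = trans (lookup-map x ℕ.pred (glue μ u)) (cong ℕ.pred (lookup-glue-off μ u x p))

lookup-fill-embed : ∀ {m} (μ : Vec Bool m) u i → lookup (fill μ u) (embed μ i) ≡ lookup u i
lookup-fill-embed μ u i =
  trans (lookup-map (embed μ i) ℕ.pred (glue μ u)) (cong ℕ.pred (lookup-glue-embed μ u i))

-- Phrased for bare relations because the induction passes to subsets of the points, including the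
-- empty one, which `FP` excludes.
Preserves : ∀ {m} → Rel ℕ 0ℓ → Rel (Fin m) 0ℓ → Vec ℕ m → Set
Preserves _∼_ R v = ∀ x y → R x y → lookup v x ∼ lookup v y

preserves? : ∀ {m} {_∼_ : Rel ℕ 0ℓ} {R : Rel (Fin m) 0ℓ} →
             Decidable _∼_ → Decidable R → ∀ v → Dec (Preserves _∼_ R v)
preserves? ∼? R? v = Fin.all? λ x → Fin.all? λ y → R? x y →-dec ∼? (lookup v x) (lookup v y)

preserves-map : ∀ {m} {_∼_ : Rel ℕ 0ℓ} {R : Rel (Fin m) 0ℓ} φ → (∀ i j → (i ∼ j) ⇔ (φ i ∼ φ j)) →
                ∀ v → Preserves _∼_ R (map φ v) ⇔ Preserves _∼_ R v
preserves-map {_∼_ = _∼_} φ p v = mk⇔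
  (λ s x y r → Equivalence.from (p _ _) (subst₂ _∼_ (lookup-map x φ v) (lookup-map y φ v) (s x y r)))
  (λ s x y r → subst₂ _∼_ (sym (lookup-map x φ v)) (sym (lookup-map y φ v)) (Equivalence.to (p _ _) (s x y r)))

module _ {m} {R : Rel (Fin m) 0ℓ} (R? : Decidable R) where

  strictly : Vec ℕ m → ℤ
  strictly = 𝟙 ∘ preserves? ℕ._<?_ R?

  weakly : Vec ℕ m → ℤ
  weakly = 𝟙 ∘ preserves? ℕ._≤?_ R?

  Minimal : Fin m → Set
  Minimal y = ∀ x → ¬ R x y

  minimal? : ∀ y → Dec (Minimal y)
  minimal? y = Fin.all? λ x → ¬? (R? x y)

  strictly-invariant : Invariant strictly
  strictly-invariant φ p v = 𝟙-⇔ (preserves-map φ p v)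
    (preserves? ℕ._<?_ R? (map φ v)) (preserves? ℕ._<?_ R? v)

  weakly-suc : ∀ v → weakly (map suc v) ≡ weakly v
  weakly-suc v = 𝟙-⇔ (preserves-map {_∼_ = ℕ._≤_} suc (λ _ _ → mk⇔ ℕ.s≤s ℕ.s≤s⁻¹) v)
    (preserves? ℕ._≤?_ R? (map suc v)) (preserves? ℕ._≤?_ R? v)

  module _ (μ : Vec Bool m) where

    restrict : Rel (Fin (size μ)) 0ℓ
    restrict = R on embed μ

    restrict? : Decidable restrict
    restrict? i j = R? (embed μ i) (embed μ j)

module _ {m} {R : Rel (Fin m) 0ℓ} (R? : Decidable R) (μ : Vec Bool m) where

  -- A strict map takes the value 0 only at points with nothing below them, and its other entries
  -- are those of u shifted by one. Conversely, if all points marked `false` are minimal, a related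
  -- pair ends at a kept point: it either compares 0 with a positive entry or lies among the kept
  -- points.
  preserves-glue : ∀ u → Preserves ℕ._<_ R (glue μ u) ⇔
                   (Off (Minimal R?) μ × Preserves ℕ._<_ (restrict R? μ) u)
  preserves-glue u = mk⇔
    (λ s → (λ y off x r → ℕ.n≮0 (subst (lookup (glue μ u) x ℕ.<_) (lookup-glue-off μ u y off) (s x y r)))
         , (λ i j r → ℕ.s<s⁻¹ (subst₂ ℕ._<_ (lookup-glue-embed μ u i) (lookup-glue-embed μ u j) (s _ _ r))))
    λ (off , s) x y r → from off s x y r (embed-view μ x) (embed-view μ y)
    where
    from : Off (Minimal R?) μ → Preserves ℕ._<_ (restrict R? μ) u → ∀ x y → R x y →
           lookup μ x ≡ false ⊎ ∃ (λ i → embed μ i ≡ x) →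
           lookup μ y ≡ false ⊎ ∃ (λ j → embed μ j ≡ y) →
           lookup (glue μ u) x ℕ.< lookup (glue μ u) y
    from off s x y r _ (inj₁ q) = ⊥-elim (off y q x r)
    from off s x _ r (inj₁ p) (inj₂ (j , refl)) =
      subst₂ ℕ._<_ (sym (lookup-glue-off μ u x p)) (sym (lookup-glue-embed μ u j)) ℕ.z<s
    from off s _ _ r (inj₂ (i , refl)) (inj₂ (j , refl)) =
      subst₂ ℕ._<_ (sym (lookup-glue-embed μ u i)) (sym (lookup-glue-embed μ u j)) (ℕ.s<s (s i j r))

  strictly-glue : ∀ u → strictly R? (glue μ u) ≡
                  𝟙 (off? (minimal? R?) μ) ℤ.* strictly (restrict? R? μ) u
  strictly-glue u = trans
    (𝟙-⇔ (preserves-glue u) (preserves? ℕ._<?_ R? (glue μ u))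
      (off? (minimal? R?) μ ×-dec preserves? ℕ._<?_ (restrict? R? μ) u))
    (𝟙-× (off? (minimal? R?) μ) (preserves? ℕ._<?_ (restrict? R? μ) u))

  -- Minimality has to be assumed here: kept points may also have value 0, so a weakly monotone
  -- vector can vanish at a removed point that is not minimal.
  preserves-fill : Off (Minimal R?) μ → ∀ u →
                   Preserves ℕ._≤_ R (fill μ u) ⇔ Preserves ℕ._≤_ (restrict R? μ) u
  preserves-fill off u = mk⇔
    (λ s i j r → subst₂ ℕ._≤_ (lookup-fill-embed μ u i) (lookup-fill-embed μ u j) (s _ _ r))
    λ s x y r → from s x y r (embed-view μ x) (embed-view μ y)
    where
    from : Preserves ℕ._≤_ (restrict R? μ) u → ∀ x y → R x y →
           lookup μ x ≡ false ⊎ ∃ (λ i → embed μ i ≡ x) →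
           lookup μ y ≡ false ⊎ ∃ (λ j → embed μ j ≡ y) →
           lookup (fill μ u) x ℕ.≤ lookup (fill μ u) y
    from s x y r _ (inj₁ q) = ⊥-elim (off y q x r)
    from s x y r (inj₁ p) (inj₂ _) = subst (ℕ._≤ lookup (fill μ u) y) (sym (lookup-fill-off μ u x p)) ℕ.z≤n
    from s _ _ r (inj₂ (i , refl)) (inj₂ (j , refl)) =
      subst₂ ℕ._≤_ (sym (lookup-fill-embed μ u i)) (sym (lookup-fill-embed μ u j)) (s i j r)

  weakly-fill : Off (Minimal R?) μ → ∀ u → weakly R? (fill μ u) ≡ weakly (restrict? R? μ) u
  weakly-fill off u = 𝟙-⇔ (preserves-fill off u)
    (preserves? ℕ._≤?_ R? (fill μ u)) (preserves? ℕ._≤?_ (restrict? R? μ) u)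

-- The alternating recursion for weak maps.

module _ {m} {R : Rel (Fin m) 0ℓ} (R? : Decidable R) where

  -- If v is 0 at x, monotonicity makes it 0 at every point below x. By induction v vanishes at none
  -- of these, so there are none and x is minimal.
  noMinimalVanishing⇔ : WellFounded R → ∀ v → Preserves ℕ._≤_ R v →
    (∀ x → ¬ (Minimal R? x × Vanish v x)) ⇔ (∀ x → ¬ Vanish v x)
  noMinimalVanishing⇔ wf v w = mk⇔
    (λ p → WF.All.wfRec wf 0ℓ (λ x → ¬ Vanish v x) λ x ih vx≡0 →
      p x ((λ y r → ih r (ℕ.n≤0⇒n≡0 (subst (lookup v y ℕ.≤_) vx≡0 (w y x r)))) , vx≡0))
    (λ p x → p x ∘ proj₂)

  -- Inclusion–exclusion over the minimal points sent to 0: a weakly monotone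
  -- map that sends no minimal point to 0 sends no point to 0.
  S-weakly-alternating : WellFounded R → ∀ n →
    ΣMask m (λ μ → sign μ ℤ.* (𝟙 (off? (minimal? R?) μ) ℤ.* S (size μ) (suc n) (weakly R? ∘ fill μ))) ≡
    S m n (weakly R?)
  S-weakly-alternating wf n = begin
    ΣMask m (λ μ → sign μ ℤ.* (χ μ ℤ.* S (size μ) (suc n) (weakly R? ∘ fill μ)))
      ≡⟨ ΣMask-cong m inside ⟩
    ΣMask m (λ μ → S m (suc n) (λ v → weakly R? v ℤ.* (sign μ ℤ.* 𝟙 (off? (Q? v) μ))))
      ≡⟨ ΣMask-S m m (suc n) _ ⟩
    S m (suc n) (λ v → ΣMask m (λ μ → weakly R? v ℤ.* (sign μ ℤ.* 𝟙 (off? (Q? v) μ))))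
      ≡⟨ S-cong m (suc n) (λ v → begin
           ΣMask m (λ μ → weakly R? v ℤ.* (sign μ ℤ.* 𝟙 (off? (Q? v) μ)))
             ≡⟨ ΣMask-* m (weakly R? v) _ ⟨
           weakly R? v ℤ.* ΣMask m (λ μ → sign μ ℤ.* 𝟙 (off? (Q? v) μ))
             ≡⟨ cong (weakly R? v ℤ.*_) (inclusion-exclusion m (Q? v)) ⟩
           weakly R? v ℤ.* 𝟙 (Fin.all? (¬? ∘ Q? v))
             -- The two conditions agree only for weakly monotone v, which the factor `weakly R? v`
             -- guarantees.
             ≡⟨ 𝟙-guard (preserves? ℕ._≤?_ R? v) (λ w →
                  𝟙-⇔ (noMinimalVanishing⇔ wf v w) (Fin.all? (¬? ∘ Q? v)) (nowhereVanishing? v)) ⟩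
           weakly R? v ℤ.* 𝟙 (nowhereVanishing? v) ∎) ⟩
    S m (suc n) (λ v → weakly R? v ℤ.* 𝟙 (nowhereVanishing? v))
      ≡⟨ S-nowhereVanishing m n (weakly R?) ⟩
    S m n (weakly R? ∘ map suc)
      ≡⟨ S-cong m n (weakly-suc R?) ⟩
    S m n (weakly R?) ∎
    where
    χ : Vec Bool m → ℤ
    χ μ = 𝟙 (off? (minimal? R?) μ)
    Q? : ∀ v x → Dec (Minimal R? x × Vanish v x)
    Q? v x = minimal? R? x ×-dec vanish? v x

    off-× : ∀ v μ → 𝟙 (off? (Q? v) μ) ≡ χ μ ℤ.* 𝟙 (off? (vanish? v) μ)
    off-× v μ = trans
      (𝟙-⇔ (mk⇔ (λ o → (λ x → proj₁ ∘ o x) , (λ x → proj₂ ∘ o x)) (λ (o , o′) x p → o x p , o′ x p))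
        (off? (Q? v) μ) (off? (minimal? R?) μ ×-dec off? (vanish? v) μ))
      (𝟙-× (off? (minimal? R?) μ) (off? (vanish? v) μ))

    inside : ∀ μ → sign μ ℤ.* (χ μ ℤ.* S (size μ) (suc n) (weakly R? ∘ fill μ)) ≡
                   S m (suc n) (λ v → weakly R? v ℤ.* (sign μ ℤ.* 𝟙 (off? (Q? v) μ)))
    inside μ = begin
      sign μ ℤ.* (χ μ ℤ.* S (size μ) (suc n) (weakly R? ∘ fill μ))
        ≡⟨ cong (λ s → sign μ ℤ.* (χ μ ℤ.* s)) (S-fill μ n (weakly R?)) ⟩
      sign μ ℤ.* (χ μ ℤ.* S m (suc n) (λ v → weakly R? v ℤ.* 𝟙 (off? (vanish? v) μ)))
        ≡⟨ ℤ.*-assoc (sign μ) (χ μ) _ ⟨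
      (sign μ ℤ.* χ μ) ℤ.* S m (suc n) (λ v → weakly R? v ℤ.* 𝟙 (off? (vanish? v) μ))
        ≡⟨ S-* m (suc n) (sign μ ℤ.* χ μ) _ ⟩
      S m (suc n) (λ v → (sign μ ℤ.* χ μ) ℤ.* (weakly R? v ℤ.* 𝟙 (off? (vanish? v) μ)))
        ≡⟨ S-cong m (suc n) (λ v → trans
             (rearrange (sign μ) (χ μ) (weakly R? v) (𝟙 (off? (vanish? v) μ)))
             (cong (λ s → weakly R? v ℤ.* (sign μ ℤ.* s)) (sym (off-× v μ)))) ⟩
      S m (suc n) (λ v → weakly R? v ℤ.* (sign μ ℤ.* 𝟙 (off? (Q? v) μ))) ∎
      where
      rearrange : ∀ s c w z → (s ℤ.* c) ℤ.* (w ℤ.* z) ≡ w ℤ.* (s ℤ.* (c ℤ.* z))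
      rearrange = solve-∀

-- Reciprocity between strict and weak maps.

-- The bound N stays fixed while the number m of points varies, so that the counts for all subsets
-- can be reflected inside one sum.
Reciprocal : ℕ → ℕ → Set₁
Reciprocal N m = m ℕ.< N → ∀ {R : Rel (Fin m) 0ℓ} (R? : Decidable R) → WellFounded R → ∀ n →
  -1ℤ ℤ.^ m ℤ.* reflect N (λ l → S m l (strictly R?)) n ≡ S m n (weakly R?)

-- A nonempty set has no map into the empty chain, and the empty set has exactly one.
reciprocity-0 : ∀ N m {R : Rel (Fin m) 0ℓ} (R? : Decidable R) →
  -1ℤ ℤ.^ m ℤ.* reflect (suc N) (λ l → S m l (strictly R?)) 0 ≡ S m 0 (weakly R?)
reciprocity-0 N zero    R? = refl
reciprocity-0 N (suc m) R? = ℤ.*-zeroʳ (-1ℤ ℤ.^ suc m)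

-- Both sides satisfy the same recursion over the sets of minimal points sent
-- to the least value: for the strict maps it is the fibre decomposition
-- S-suc, and for the weak maps S-weakly-alternating.
reciprocity : ∀ N m → Reciprocal N m
reciprocity (suc N) = <-rec (Reciprocal (suc N)) step
  where
  step : ∀ m → (∀ {k} → k ℕ.< m → Reciprocal (suc N) k) → Reciprocal (suc N) m
  step m ih m<N R? wf zero    = reciprocity-0 N m R?
  -- The case n for the same relation makes the two sums over masks equal; the case `suc n` for
  -- fewer points makes all terms but the full one equal.
  step m ih m<N {R} R? wf (suc n) = begin
    -1ℤ ℤ.^ m ℤ.* reflect (suc N) F (suc n)
      ≡⟨ cong (-1ℤ ℤ.^ m ℤ.*_) (reflect-cong (suc N) (λ l → trans
           (S-full m l (strictly R?))
           (S-cong m l (strictly-invariant R? suc λ _ _ → mk⇔ ℕ.s<s ℕ.s<s⁻¹))) (suc n)) ⟨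
    T (full m)
      ≡⟨ ΣMask-cancel m sums proper ⟩
    U (full m)
      ≡⟨ cong₂ (λ s c → s ℤ.* (c ℤ.* S (size (full m)) (suc n) (weakly R? ∘ fill (full m))))
           (sign-full m) (𝟙-yes (off? (minimal? R?) (full m)) full-off) ⟩
    1ℤ ℤ.* (1ℤ ℤ.* S (size (full m)) (suc n) (weakly R? ∘ fill (full m)))
      ≡⟨ trans (ℤ.*-identityˡ _) (ℤ.*-identityˡ _) ⟩
    S (size (full m)) (suc n) (weakly R? ∘ fill (full m))
      ≡⟨ S-fill-full m (suc n) (weakly R?) ⟩
    S m (suc n) (weakly R?) ∎
    where
    F : ℕ → ℤ
    F l = S m l (strictly R?)
    χ : Vec Bool m → ℤ
    χ μ = 𝟙 (off? (minimal? R?) μ)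
    T U : Vec Bool m → ℤ
    T μ = -1ℤ ℤ.^ m ℤ.* reflect (suc N) (λ l → S (size μ) l (strictly R? ∘ glue μ)) (suc n)
    U μ = sign μ ℤ.* (χ μ ℤ.* S (size μ) (suc n) (weakly R? ∘ fill μ))

    full-off : Off (Minimal R?) (full m)
    full-off x p with () ← trans (sym (lookup-replicate x true)) p

    sums : ΣMask m T ≡ ΣMask m U
    sums = begin
      ΣMask m T
        ≡⟨ ΣMask-* m (-1ℤ ℤ.^ m) _ ⟨
      -1ℤ ℤ.^ m ℤ.* ΣMask m (λ μ → reflect (suc N) (λ l → S (size μ) l (strictly R? ∘ glue μ)) (suc n))
        ≡⟨ cong (-1ℤ ℤ.^ m ℤ.*_) (reflect-ΣMask (suc N) m (λ l μ → S (size μ) l (strictly R? ∘ glue μ)) (suc n)) ⟨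
      -1ℤ ℤ.^ m ℤ.* reflect (suc N) (λ l → ΣMask m (λ μ → S (size μ) l (strictly R? ∘ glue μ))) (suc n)
        ≡⟨ cong (-1ℤ ℤ.^ m ℤ.*_) (reflect-cong (suc N) (λ l → S-suc m l (strictly R?)) (suc n)) ⟨
      -1ℤ ℤ.^ m ℤ.* reflect (suc N) (F ∘ suc) (suc n)
        -- The strict count at l + 1, read at l = -(n+1), is the strict count at -n, where the inner
        -- induction applies.
        ≡⟨ cong (-1ℤ ℤ.^ m ℤ.*_) (reflect-shift (suc N) F
             (S-Deg< (suc N) m (strictly R?) m<N (strictly-invariant R?)) n) ⟩
      -1ℤ ℤ.^ m ℤ.* reflect (suc N) F n
        ≡⟨ step m ih m<N R? wf n ⟩
      S m n (weakly R?)
        ≡⟨ S-weakly-alternating R? wf n ⟨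
      ΣMask m U ∎

    proper : ∀ μ → size μ ℕ.< m → T μ ≡ U μ
    proper μ q = begin
      T μ
        ≡⟨ cong (-1ℤ ℤ.^ m ℤ.*_) (trans
             (reflect-cong (suc N) (λ l → trans
               (S-cong (size μ) l (strictly-glue R? μ))
               (sym (S-* (size μ) l (χ μ) (strictly (restrict? R? μ))))) (suc n))
             (reflect-* (suc N) (χ μ) (λ l → S (size μ) l (strictly (restrict? R? μ))) (suc n))) ⟩
      -1ℤ ℤ.^ m ℤ.* (χ μ ℤ.* r)
        -- Of (-1)^m, the removed points contribute the sign in `U μ` and the kept points the sign
        -- in the induction hypothesis.
        ≡⟨ cong (ℤ._* (χ μ ℤ.* r)) (sign-size μ) ⟨
      (sign μ ℤ.* -1ℤ ℤ.^ size μ) ℤ.* (χ μ ℤ.* r)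
        ≡⟨ rearrange (sign μ) (-1ℤ ℤ.^ size μ) (χ μ) r ⟩
      sign μ ℤ.* (χ μ ℤ.* (-1ℤ ℤ.^ size μ ℤ.* r))
        ≡⟨ cong (sign μ ℤ.*_) (𝟙-guard (off? (minimal? R?) μ) λ off → trans
             (ih q (ℕ.<-trans q m<N) (restrict? R? μ) (On.wellFounded (embed μ) wf) (suc n))
             (sym (S-cong (size μ) (suc n) (weakly-fill R? μ off)))) ⟩
      U μ ∎
      where
      r : ℤ
      r = reflect (suc N) (λ l → S (size μ) l (strictly (restrict? R? μ))) (suc n)
      rearrange : ∀ s e c r → (s ℤ.* e) ℤ.* (c ℤ.* r) ≡ s ℤ.* (c ℤ.* (e ℤ.* r))
      rearrange = solve-∀

-- Expansion of the weak order series in the basis.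

module _ {k} (P : FP k) where
  open FP P

  -- Weak maps are rephrased through the strict order, so that both counts refer to one well-founded
  -- relation; a pair of equal points satisfies the weak inequality by reflexivity.
  Ω≡S : ∀ n → + Ω P n ≡ S k n (weakly _<?_)
  Ω≡S n = trans (+-sum {n ℕ.^ k} _) (sum≡S k n _ (weakly _<?_) λ c →
    𝟙-⇔ (mk⇔
      (λ s x y x<y → subst₂ ℕ._≤_ (sym (lookup∘tabulate _ x)) (sym (lookup∘tabulate _ y)) (s x y (proj₁ x<y)))
      (λ s x y x≤y → weak c s x y x≤y (x Fin.≟ y)))
      (weak? P (finToFun c)) (preserves? ℕ._≤?_ _<?_ (tabulate (toℕ ∘ finToFun c))))
    where
    weak : ∀ (c : Fin (n ℕ.^ k)) → Preserves ℕ._≤_ _<_ (tabulate (toℕ ∘ finToFun c)) →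
           ∀ x y → x ≤ y → Dec (x ≡ y) → finToFun {n} {k} c x Fin.≤ finToFun {n} {k} c y
    weak c s x y x≤y (yes refl) = ℕ.≤-refl
    weak c s x y x≤y (no x≢y)   =
      subst₂ ℕ._≤_ (lookup∘tabulate _ x) (lookup∘tabulate _ y) (s x y (x≤y , x≢y))

  <-wellFounded : WellFounded _<_
  <-wellFounded = po-wellFounded (IsDecPartialOrder.isPartialOrder isDecPartialOrder)

  -- By reciprocity Ω(P,n) is, up to the sign (-1)^k, the value of Ω° at -n. `reflect-newton`
  -- expands that value through the differences at 0, which are the integers `d P i`.
  𝔷⁺-expansion : ∀ n → 𝔷⁺ P n ≡
    ∑[ j < k ] (-1ℤ ℤ.^ (k ℕ.∸ suc (toℕ j)) ℤ.* d P (suc (toℕ j)) ℤ.* basis⁺ (suc (toℕ j)) n)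
  𝔷⁺-expansion zero = sym (∑-zero {k} λ j → trans
    (cong (-1ℤ ℤ.^ (k ℕ.∸ suc (toℕ j)) ℤ.* d P (suc (toℕ j)) ℤ.*_) (basis⁺-0 (suc (toℕ j))))
    (ℤ.*-zeroʳ (-1ℤ ℤ.^ (k ℕ.∸ suc (toℕ j)) ℤ.* d P (suc (toℕ j)))))
  𝔷⁺-expansion (suc n) = begin
    + Ω P (suc n)
      ≡⟨ Ω≡S (suc n) ⟩
    S k (suc n) (weakly _<?_)
      ≡⟨ reciprocity (suc k) k (ℕ.n<1+n k) _<?_ <-wellFounded (suc n) ⟨
    -1ℤ ℤ.^ k ℤ.* reflect (suc k) (λ l → S k l (strictly _<?_)) (suc n)
      ≡⟨ cong (-1ℤ ℤ.^ k ℤ.*_) (reflect-cong (suc k) (Ω°≡S P) (suc n)) ⟨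
    -1ℤ ℤ.^ k ℤ.* reflect (suc k) (λ l → + Ω° P l) (suc n)
      ≡⟨ cong (-1ℤ ℤ.^ k ℤ.*_) (reflect-newton (suc k) (λ l → + Ω° P l) n) ⟩
    -1ℤ ℤ.^ k ℤ.* (1ℤ ℤ.* (+ Ω° P 0) ℤ.* basis⁺ 0 (suc n) ℤ.+ ∑[ j < k ] t j)
      -- The constant Newton coefficient is Ω°(P,0), which is 0 because P is nonempty; so the sum
      -- starts at index 1.
      ≡⟨ cong (λ a → -1ℤ ℤ.^ k ℤ.* (1ℤ ℤ.* (+ a) ℤ.* basis⁺ 0 (suc n) ℤ.+ ∑[ j < k ] t j)) (Ω°0≡0 P) ⟩
    -1ℤ ℤ.^ k ℤ.* (1ℤ ℤ.* 0ℤ ℤ.* basis⁺ 0 (suc n) ℤ.+ ∑[ j < k ] t j)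
      ≡⟨ dropFirst (-1ℤ ℤ.^ k) (basis⁺ 0 (suc n)) (∑[ j < k ] t j) ⟩
    -1ℤ ℤ.^ k ℤ.* ∑[ j < k ] t j
      ≡⟨ *-distribˡ-sum {k} (-1ℤ ℤ.^ k) t ⟩
    ∑[ j < k ] (-1ℤ ℤ.^ k ℤ.* t j)
      ≡⟨ sum-cong-≗ {k} (λ j → trans
           (reassociate (-1ℤ ℤ.^ k) (-1ℤ ℤ.^ suc (toℕ j)) (d P (suc (toℕ j))) (basis⁺ (suc (toℕ j)) (suc n)))
           (cong (λ s → s ℤ.* d P (suc (toℕ j)) ℤ.* basis⁺ (suc (toℕ j)) (suc n)) (signs (Fin.toℕ<n j)))) ⟩
    ∑[ j < k ] (-1ℤ ℤ.^ (k ℕ.∸ suc (toℕ j)) ℤ.* d P (suc (toℕ j)) ℤ.* basis⁺ (suc (toℕ j)) (suc n)) ∎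
    where
    t : Fin k → ℤ
    t j = -1ℤ ℤ.^ suc (toℕ j) ℤ.* d P (suc (toℕ j)) ℤ.* basis⁺ (suc (toℕ j)) (suc n)
    dropFirst : ∀ e b s → e ℤ.* (1ℤ ℤ.* 0ℤ ℤ.* b ℤ.+ s) ≡ e ℤ.* s
    dropFirst = solve-∀
    reassociate : ∀ e s c b → e ℤ.* (s ℤ.* c ℤ.* b) ≡ (e ℤ.* s) ℤ.* c ℤ.* b
    reassociate = solve-∀
    square : ∀ i → -1ℤ ℤ.^ i ℤ.* -1ℤ ℤ.^ i ≡ 1ℤ
    square zero    = refl
    square (suc i) = trans (lemma (-1ℤ ℤ.^ i)) (square i)
      where
      lemma : ∀ a → (-1ℤ ℤ.* a) ℤ.* (-1ℤ ℤ.* a) ≡ a ℤ.* a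
      lemma = solve-∀
    signs : ∀ {i l} → i ℕ.≤ l → -1ℤ ℤ.^ l ℤ.* -1ℤ ℤ.^ i ≡ -1ℤ ℤ.^ (l ℕ.∸ i)
    signs {i} {l} i≤l = begin
      -1ℤ ℤ.^ l ℤ.* -1ℤ ℤ.^ i
        ≡⟨ cong (λ e → -1ℤ ℤ.^ e ℤ.* -1ℤ ℤ.^ i) (ℕ.m∸n+n≡m i≤l) ⟨
      -1ℤ ℤ.^ (l ℕ.∸ i ℕ.+ i) ℤ.* -1ℤ ℤ.^ i
        ≡⟨ cong (ℤ._* -1ℤ ℤ.^ i) (ℤ.^-distribˡ-+-* -1ℤ (l ℕ.∸ i) i) ⟩
      -1ℤ ℤ.^ (l ℕ.∸ i) ℤ.* -1ℤ ℤ.^ i ℤ.* -1ℤ ℤ.^ i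
        ≡⟨ ℤ.*-assoc (-1ℤ ℤ.^ (l ℕ.∸ i)) (-1ℤ ℤ.^ i) (-1ℤ ℤ.^ i) ⟩
      -1ℤ ℤ.^ (l ℕ.∸ i) ℤ.* (-1ℤ ℤ.^ i ℤ.* -1ℤ ℤ.^ i)
        ≡⟨ cong (-1ℤ ℤ.^ (l ℕ.∸ i) ℤ.*_) (square i) ⟩
      -1ℤ ℤ.^ (l ℕ.∸ i) ℤ.* 1ℤ
        ≡⟨ ℤ.*-identityʳ (-1ℤ ℤ.^ (l ℕ.∸ i)) ⟩
      -1ℤ ℤ.^ (l ℕ.∸ i) ∎

-- The isomorphism of algebras.

toWeakSurjective : Element 𝔷⁺ → Element 𝔷ˢ
toWeakSurjective u = record
  { poset      = Element.poset u
  ; series     = 𝔷ˢ (Element.poset u)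
  ; producedBy = λ _ → refl
  }

-- The coefficients in `𝔷⁺-expansion` are those in the definition of `𝔷ˢ`, so exchanging the basis
-- turns one series into the other by computation.
toWeakSurjective-inducedBy : toWeakSurjective InducedBy changeOfBasis
toWeakSurjective-inducedBy u = ≅-refl , record
  { series      = series
  ; bound       = points
  ; coefficient = λ j → -1ℤ ℤ.^ (points ℕ.∸ suc (toℕ j)) ℤ.* d poset (suc (toℕ j))
  ; expansion   = λ n → trans (producedBy n) (𝔷⁺-expansion poset n)
  } , (λ _ → refl) , λ _ → refl
  where open Element u

toWeakSurjective-isOperadicIsomorphism :
  IsOperadicIsomorphism weakOrderSeries weakSurjectiveOrderSeries toWeakSurjective
toWeakSurjective-isOperadicIsomorphism = record
  { isBijection = record
    { isInjection = record
      { isCongruent = record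
        { cong           = λ (e , _) → e , 𝔷ˢ-cong e
        ; isEquivalence₁ = Setoid.isEquivalence (FPAlgebra.setoid weakOrderSeries)
        ; isEquivalence₂ = Setoid.isEquivalence (FPAlgebra.setoid weakSurjectiveOrderSeries)
        }
      ; injective = λ {u} {v} (e , _) → e , λ n →
          trans (Element.producedBy u n) (trans (𝔷⁺-cong e n) (sym (Element.producedBy v n)))
      }
    ; surjective = λ v →
        record { poset = Element.poset v ; series = 𝔷⁺ (Element.poset v) ; producedBy = λ _ → refl }
      , λ (e , _) → e , λ n → trans (𝔷ˢ-cong e n) (sym (Element.producedBy v n))
    }
  -- The map keeps posets, so both sides carry the same lexicographic sum and the series computed
  -- from it.
  ; commutes = λ P u → ≅-refl , λ _ → refl
  }

corollary3p6 : IsLinearExtension changeOfBasis ×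
    Σ[ Φ ∈ (Element 𝔷⁺ → Element 𝔷ˢ) ]
    (Φ InducedBy changeOfBasis ×
    IsOperadicIsomorphism weakOrderSeries weakSurjectiveOrderSeries Φ)
corollary3p6 = changeOfBasis-isLinearExtension ,
  toWeakSurjective , toWeakSurjective-inducedBy , toWeakSurjective-isOperadicIsomorphism
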